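{- Let $G$ be a connected graph with two distinct marked vertices $x,y$, and for $n\ge 3$ let $F_n(G)=F_n(G,x,y)$ be the generalized flower graph with base graph $G$. Then $$\lim_{n\to\infty}\ \max_{u,v\in V(F_n(G))} r_{F_n(G)}(u,v)=\infty .$$
   Context: For a connected graph $H$ with vertex set $\{1,\dots,N\}$ and Laplacian matrix $L$, the resistance distance (effective resistance) between vertices $i,j$ is $r_H(i,j)=(e_i-e_j)^T L^\dagger (e_i-e_j)$, where $e_i$ is the $i$th standard unit vector and $L^\dagger$ is the Moore–Penrose pseudoinverse of $L$. Generalized flower graph: let $G$ be a graph, $x\ne y$ two vertices of $G$, and $n\ge 3$. $F_n(G,x,y)$ (written $F_n(G)$) is the graph obtained by taking $n$ vertex-disjoint copies $G_1,\dots,G_n$ of $G$ (the petals), with $x_i,y_i$ the copies of $x,y$ in $G_i$, and identifying $y_i$ with $x_{i+1}$ for $1\le i<n$ and $y_n$ with $x_1$. -}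

module Defs where

open import Algebra.Bundles using (CommutativeRing)
open import Data.Bool.Base using (if_then_else_)
open import Data.Empty using (⊥-elim)
open import Data.Fin.Base using (Fin; zero; suc; toℕ; combine; remQuot; punchIn; punchOut)
open import Data.Fin.Properties as Fin
  using (toℕ<n; combine-injective; combine-remQuot; any?; punchOut-cong; punchOut-injective;
         punchInᵢ≢i; punchOut-punchIn; toℕ-fromℕ<)
open import Data.List.Base using (List; cartesianProductWith; allFin)
open import Data.List.Membership.Propositional.Properties
  using (∈-allFin; ∈-cartesianProductWith⁺; ∈-cartesianProductWith⁻)
import Data.List.Relation.Unary.All as All
open import Data.Nat.Base as ℕ using (ℕ; zero; suc; s≤s; z≤n; NonZero; >-nonZero)
open import Data.Nat.DivMod using (_mod_; _%_; m<n⇒m%n≡m; n%n≡0; m%n<n)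
import Data.Nat.Properties as ℕ
open import Data.Product.Base using (_×_; _,_; proj₁; proj₂; ∃; ∃₂; uncurry)
open import Data.Rational.Base using (ℚ; 0ℚ; 1ℚ; _+_; _-_; _*_; -_; 1/_; _≤_; ≢-nonZero; nonNegative)
import Data.Rational.Properties as ℚ
open import Data.Rational.Solver using (module +-*-Solver)
open import Data.Sum.Base using (_⊎_; inj₁; inj₂)
open import Data.Vec.Functional using (Vector)
open import Function.Base using (_∘_)
open import Relation.Binary.Construct.Closure.Equivalence using (EqClosure; gfold; return; symmetric)
open import Relation.Binary.Construct.Closure.ReflexiveTransitive using (Star; _◅◅_; ε)
open import Relation.Binary.Bundles using (DecTotalOrder)
open import Relation.Binary.Core using (Rel)
open import Relation.Binary.Definitions using (Decidable; Symmetric; Irreflexive)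
open import Relation.Binary.PropositionalEquality
open import Relation.Nullary.Decidable using (yes; no; does; _×-dec_)
open import Level using (0ℓ)

open import Algebra.Properties.Semiring.Sum
  (CommutativeRing.semiring ℚ.+-*-commutativeRing) public
  using (sum; sum-syntax; sum-cong-≗; ∑-distrib-+; ∑-comm; *-distribˡ-sum; *-distribʳ-sum; sum-replicate-zero)
open import Data.List.Extrema (DecTotalOrder.totalOrder ℚ.≤-decTotalOrder)
  using (max; argmax-sel; xs≤max)

private
  variable
    m n k l N : ℕ

-- Rational entries lose nothing: the Laplacian is an integer matrix, and the
-- four Penrose equations, whose real solution is unique, are solved below
-- over ℚ.

Matrix : ℕ → ℕ → Set
Matrix m n = Fin m → Fin n → ℚ

infix 4 _≐_

_≐_ : Matrix m n → Matrix m n → Set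
A ≐ B = ∀ i j → A i j ≡ B i j

infix 9 _ᵀ _†

_ᵀ : Matrix m n → Matrix n m
(A ᵀ) i j = A j i

infixl 8 _∙_ _⊗_ _⊛_ _⊙_

_∙_ : Vector ℚ n → Vector ℚ n → ℚ
_∙_ {n} u v = ∑[ i < n ] (u i * v i)

_⊛_ : Matrix m n → Vector ℚ n → Vector ℚ m
(A ⊛ v) i = A i ∙ v

_⊙_ : Vector ℚ m → Matrix m n → Vector ℚ n
(u ⊙ A) j = u ∙ (A ᵀ) j

_⊗_ : Matrix m n → Matrix n k → Matrix m k
(A ⊗ B) i j = A i ∙ (B ᵀ) j

record IsMoorePenrose (A : Matrix m n) (P : Matrix n m) : Set where
  field
    APA≐A : A ⊗ P ⊗ A ≐ A
    PAP≐P : P ⊗ A ⊗ P ≐ P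
    AP-sym : (A ⊗ P) ᵀ ≐ A ⊗ P
    PA-sym : (P ⊗ A) ᵀ ≐ P ⊗ A

open +-*-Solver using (solve; _:=_; _:+_; _:*_; _:-_; :-_; con)
open ≡-Reasoning

∙-cong : {u u′ v v′ : Vector ℚ n} → u ≗ u′ → v ≗ v′ → u ∙ v ≡ u′ ∙ v′
∙-cong p q = sum-cong-≗ λ i → cong₂ _*_ (p i) (q i)

∙-comm : (u v : Vector ℚ n) → u ∙ v ≡ v ∙ u
∙-comm u v = sum-cong-≗ λ i → ℚ.*-comm (u i) (v i)

∙-distribˡ-+ : (u v w : Vector ℚ n) → u ∙ (λ i → v i + w i) ≡ u ∙ v + u ∙ w
∙-distribˡ-+ u v w =
  trans (sum-cong-≗ λ i → ℚ.*-distribˡ-+ (u i) (v i) (w i))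
        (∑-distrib-+ (λ i → u i * v i) (λ i → u i * w i))

∙-*ʳ : (u v : Vector ℚ n) (c : ℚ) → u ∙ (λ i → v i * c) ≡ u ∙ v * c
∙-*ʳ u v c =
  trans (sum-cong-≗ λ i → sym (ℚ.*-assoc (u i) (v i) c)) (sym (*-distribʳ-sum c λ i → u i * v i))

∙-*ˡ : (u v : Vector ℚ n) (c : ℚ) → u ∙ (λ i → c * v i) ≡ c * u ∙ v
∙-*ˡ u v c = begin
  u ∙ (λ i → c * v i)  ≡⟨ ∙-cong {u = u} (λ _ → refl) (λ i → ℚ.*-comm c (v i)) ⟩
  u ∙ (λ i → v i * c)  ≡⟨ ∙-*ʳ u v c ⟩
  u ∙ v * c            ≡⟨ ℚ.*-comm (u ∙ v) c ⟩
  c * u ∙ v            ∎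

∙-distribˡ-- : (u v w : Vector ℚ n) → u ∙ (λ i → v i - w i) ≡ u ∙ v - u ∙ w
∙-distribˡ-- u v w = begin
  u ∙ (λ i → v i - w i)            ≡⟨ ∙-distribˡ-+ u v (-_ ∘ w) ⟩
  u ∙ v + u ∙ (-_ ∘ w)             ≡⟨ cong (u ∙ v +_) (∙-cong {u = u} (λ _ → refl) neg) ⟩
  u ∙ v + u ∙ (λ i → - 1ℚ * w i)   ≡⟨ cong (u ∙ v +_) (∙-*ˡ u w (- 1ℚ)) ⟩
  u ∙ v + - 1ℚ * u ∙ w             ≡⟨ cong (u ∙ v +_) (sym (ℚ.neg-distribˡ-* 1ℚ (u ∙ w))) ⟩
  u ∙ v + - (1ℚ * u ∙ w)           ≡⟨ cong (λ t → u ∙ v - t) (ℚ.*-identityˡ (u ∙ w)) ⟩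
  u ∙ v - u ∙ w                    ∎
  where
  neg : ∀ i → - w i ≡ - 1ℚ * w i
  neg i = trans (cong -_ (sym (ℚ.*-identityˡ (w i)))) (ℚ.neg-distribˡ-* 1ℚ (w i))

∙-zeroʳ : (u : Vector ℚ n) → u ∙ (λ _ → 0ℚ) ≡ 0ℚ
∙-zeroʳ {n} u = trans (sum-cong-≗ λ i → ℚ.*-zeroʳ (u i)) (sum-replicate-zero n)

∙-assoc : (u : Vector ℚ m) (A : Matrix m n) (v : Vector ℚ n) → (u ⊙ A) ∙ v ≡ u ∙ (A ⊛ v)
∙-assoc {m} {n} u A v = begin
  ∑[ j < n ] ((∑[ i < m ] (u i * A i j)) * v j)
    ≡⟨ sum-cong-≗ (λ j → *-distribʳ-sum (v j) (λ i → u i * A i j)) ⟩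
  ∑[ j < n ] ∑[ i < m ] (u i * A i j * v j)
    ≡⟨ ∑-comm (λ j i → u i * A i j * v j) ⟩
  ∑[ i < m ] ∑[ j < n ] (u i * A i j * v j)
    ≡⟨ sum-cong-≗ (λ i → sum-cong-≗ λ j → ℚ.*-assoc (u i) (A i j) (v j)) ⟩
  ∑[ i < m ] ∑[ j < n ] (u i * (A i j * v j))
    ≡⟨ sum-cong-≗ (λ i → *-distribˡ-sum (u i) (λ j → A i j * v j)) ⟨
  ∑[ i < m ] (u i * ∑[ j < n ] (A i j * v j))
    ∎

⊗-assoc : (A : Matrix m n) (B : Matrix n k) (C : Matrix k l) → A ⊗ B ⊗ C ≐ A ⊗ (B ⊗ C)
⊗-assoc A B C i j = ∙-assoc (A i) B ((C ᵀ) j)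

x*x≥0 : ∀ x → 0ℚ ≤ x * x
x*x≥0 x with ℚ.≤-total 0ℚ x
... | inj₁ 0≤x = subst (_≤ x * x) (ℚ.*-zeroʳ x) (ℚ.*-monoˡ-≤-nonNeg x {{nonNegative 0≤x}} 0≤x)
... | inj₂ x≤0 = subst₂ _≤_ (ℚ.*-zeroʳ (- x)) (solve 1 (λ x → :- x :* :- x := x :* x) refl x)
                   (ℚ.*-monoˡ-≤-nonNeg (- x) {{nonNegative 0≤-x}} 0≤-x)
  where
  0≤-x : 0ℚ ≤ - x
  0≤-x = ℚ.neg-antimono-≤ x≤0

∙-nonNeg : (u : Vector ℚ n) → 0ℚ ≤ u ∙ u
∙-nonNeg {zero}  u = ℚ.≤-refl
∙-nonNeg {suc n} u = ℚ.+-mono-≤ (x*x≥0 (u zero)) (∙-nonNeg (u ∘ suc))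

x*x≡0⇒x≡0 : ∀ x → x * x ≡ 0ℚ → x ≡ 0ℚ
x*x≡0⇒x≡0 x eq with x ℚ.≟ 0ℚ
... | yes x≡0 = x≡0
... | no  x≢0 = begin
  x                 ≡⟨ ℚ.*-identityˡ x ⟨
  1ℚ * x            ≡⟨ cong (_* x) (ℚ.*-inverseˡ x) ⟨
  1/ x * x * x      ≡⟨ ℚ.*-assoc (1/ x) x x ⟩
  1/ x * (x * x)    ≡⟨ cong (1/ x *_) eq ⟩
  1/ x * 0ℚ         ≡⟨ ℚ.*-zeroʳ (1/ x) ⟩
  0ℚ                ∎
  where instance _ = ≢-nonZero x≢0

∙-definite : (u : Vector ℚ n) → u ∙ u ≡ 0ℚ → ∀ i → u i ≡ 0ℚ
∙-definite {suc n} u eq = λ { zero → x*x≡0⇒x≡0 _ head≡0 ; (suc i) → ∙-definite (u ∘ suc) tail≡0 i }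
  where
  h t : ℚ
  h = u zero * u zero
  t = (u ∘ suc) ∙ (u ∘ suc)
  head≡0 : h ≡ 0ℚ
  head≡0 = ℚ.≤-antisym
    (subst₂ _≤_ (ℚ.+-identityʳ h) eq (ℚ.+-monoʳ-≤ h (∙-nonNeg (u ∘ suc)))) (x*x≥0 (u zero))
  tail≡0 : t ≡ 0ℚ
  tail≡0 = begin
    t        ≡⟨ ℚ.+-identityˡ t ⟨
    0ℚ + t   ≡⟨ cong (_+ t) head≡0 ⟨
    h + t    ≡⟨ eq ⟩
    0ℚ       ∎

-- One step of Greville's recursion: prepending the column a to A prepends
-- a row b to P and subtracts d b from P, where d = P a and c = a - A d.

module Greville (A : Matrix m n) (P : Matrix n m) (mp : IsMoorePenrose A P) (a : Vector ℚ m) where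

  open IsMoorePenrose mp

  A⁺ : Matrix m (suc n)
  A⁺ i zero    = a i
  A⁺ i (suc j) = A i j

  d : Vector ℚ n
  d = P ⊛ a

  c : Vector ℚ m
  c i = a i - (A ⊛ d) i

  P⁺ : Vector ℚ m → Matrix (suc n) m
  P⁺ b zero    j = b j
  P⁺ b (suc k) j = P k j - d k * b j

  PAd≡d : ∀ k → ((P ⊗ A) ⊛ d) k ≡ d k
  PAd≡d k = trans (sym (∙-assoc ((P ⊗ A) k) P a)) (∙-cong {v = a} (PAP≐P k) (λ _ → refl))

  Pc≡0 : ∀ k → (P ⊛ c) k ≡ 0ℚ
  Pc≡0 k = begin
    (P ⊛ c) k                      ≡⟨ ∙-distribˡ-- (P k) a (A ⊛ d) ⟩
    d k - P k ∙ (A ⊛ d)            ≡⟨ cong (λ t → d k - t) (trans (sym (∙-assoc (P k) A d)) (PAd≡d k)) ⟩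
    d k - d k                      ≡⟨ ℚ.+-inverseʳ (d k) ⟩
    0ℚ                             ∎

  cA≡0 : ∀ j → (c ⊙ A) j ≡ 0ℚ
  cA≡0 j = begin
    c ∙ α                          ≡⟨ ∙-comm c α ⟩
    α ∙ c                          ≡⟨ ∙-distribˡ-- α a (A ⊛ d) ⟩
    α ∙ a - α ∙ (A ⊛ d)            ≡⟨ cong (λ t → α ∙ a - t) step ⟩
    α ∙ a - α ∙ a                  ≡⟨ ℚ.+-inverseʳ (α ∙ a) ⟩
    0ℚ                             ∎
    where
    α : Vector ℚ m
    α = (A ᵀ) j
    αAP : ∀ i → (α ⊙ (A ⊗ P)) i ≡ α i
    αAP i = begin
      α ∙ (λ k → (A ⊗ P) k i)      ≡⟨ ∙-cong {u = α} (λ _ → refl) (AP-sym i) ⟩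
      α ∙ (A ⊗ P) i                ≡⟨ ∙-comm α ((A ⊗ P) i) ⟩
      (A ⊗ P) i ∙ α                ≡⟨ APA≐A i j ⟩
      α i                          ∎
    step : α ∙ (A ⊛ d) ≡ α ∙ a
    step = begin
      α ∙ (A ⊛ d)                  ≡⟨ ∙-cong {u = α} (λ _ → refl) (λ i → sym (∙-assoc (A i) P a)) ⟩
      α ∙ ((A ⊗ P) ⊛ a)            ≡⟨ ∙-assoc α (A ⊗ P) a ⟨
      (α ⊙ (A ⊗ P)) ∙ a            ≡⟨ ∙-cong {v = a} αAP (λ _ → refl) ⟩
      α ∙ a                        ∎

  module _ (b : Vector ℚ m)
           (cb-sym : ∀ i j → c i * b j ≡ c j * b i)
           (cbA    : ∀ i j → c i * (b ⊙ A) j ≡ 0ℚ)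
           (cba    : ∀ i → c i * b ∙ a ≡ c i)
           (bA     : ∀ j → (b ⊙ A) j ≡ (1ℚ - b ∙ a) * d j)
           (bAP    : ∀ j → b ∙ ((A ⊗ P) ᵀ) j + b ∙ c * b j ≡ b j) where

    A⁺P⁺ : ∀ i j → (A⁺ ⊗ P⁺ b) i j ≡ (A ⊗ P) i j + c i * b j
    A⁺P⁺ i j = begin
      a i * b j + A i ∙ (λ k → P k j - d k * b j)
        ≡⟨ cong (a i * b j +_) (∙-distribˡ-- (A i) ((P ᵀ) j) (λ k → d k * b j)) ⟩
      a i * b j + ((A ⊗ P) i j - A i ∙ (λ k → d k * b j))
        ≡⟨ cong (λ t → a i * b j + ((A ⊗ P) i j - t)) (∙-*ʳ (A i) d (b j)) ⟩
      a i * b j + ((A ⊗ P) i j - (A ⊛ d) i * b j)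
        ≡⟨ solve 4 (λ a b p q → a :* b :+ (p :- q :* b) := p :+ (a :- q) :* b) refl
             (a i) (b j) ((A ⊗ P) i j) ((A ⊛ d) i) ⟩
      (A ⊗ P) i j + c i * b j
        ∎

    row : ∀ k (v : Vector ℚ m) → P⁺ b (suc k) ∙ v ≡ P k ∙ v - d k * b ∙ v
    row k v = begin
      P⁺ b (suc k) ∙ v                   ≡⟨ ∙-comm (P⁺ b (suc k)) v ⟩
      v ∙ P⁺ b (suc k)                   ≡⟨ ∙-distribˡ-- v (P k) (λ j → d k * b j) ⟩
      v ∙ P k - v ∙ (λ j → d k * b j)    ≡⟨ cong (λ t → v ∙ P k - t) (∙-*ˡ v b (d k)) ⟩
      v ∙ P k - d k * v ∙ b              ≡⟨ cong₂ (λ s t → s - d k * t) (∙-comm v (P k)) (∙-comm v b) ⟩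
      P k ∙ v - d k * b ∙ v              ∎

    split : (u : Vector ℚ m) (v : Vector ℚ m) (w : Vector ℚ m) (t : ℚ) →
            u ∙ (λ i → v i + w i * t) ≡ u ∙ v + u ∙ w * t
    split u v w t = trans (∙-distribˡ-+ u v (λ i → w i * t)) (cong (u ∙ v +_) (∙-*ʳ u w t))

    AP+cb : ∀ i (v : Vector ℚ m) → (A⁺ ⊗ P⁺ b) i ∙ v ≡ (A ⊗ P) i ∙ v + c i * b ∙ v
    AP+cb i v = begin
      (A⁺ ⊗ P⁺ b) i ∙ v                              ≡⟨ ∙-cong {v = v} (A⁺P⁺ i) (λ _ → refl) ⟩
      (λ j → (A ⊗ P) i j + c i * b j) ∙ v            ≡⟨ ∙-comm _ v ⟩
      v ∙ (λ j → (A ⊗ P) i j + c i * b j)            ≡⟨ ∙-distribˡ-+ v ((A ⊗ P) i) (λ j → c i * b j) ⟩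
      v ∙ (A ⊗ P) i + v ∙ (λ j → c i * b j)          ≡⟨ cong (v ∙ (A ⊗ P) i +_) (∙-*ˡ v b (c i)) ⟩
      v ∙ (A ⊗ P) i + c i * v ∙ b                    ≡⟨ cong₂ (λ s t → s + c i * t) (∙-comm v _) (∙-comm v b) ⟩
      (A ⊗ P) i ∙ v + c i * b ∙ v                    ∎

    row₀ : ∀ j → b ∙ ((A⁺ ⊗ P⁺ b) ᵀ) j ≡ b j
    row₀ j = begin
      b ∙ ((A⁺ ⊗ P⁺ b) ᵀ) j                     ≡⟨ ∙-cong {u = b} (λ _ → refl) (λ i → A⁺P⁺ i j) ⟩
      b ∙ (λ i → (A ⊗ P) i j + c i * b j)       ≡⟨ split b (((A ⊗ P) ᵀ) j) c (b j) ⟩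
      b ∙ ((A ⊗ P) ᵀ) j + b ∙ c * b j           ≡⟨ bAP j ⟩
      b j                                       ∎

    P⁺A⁺-sym : (P⁺ b ⊗ A⁺) ᵀ ≐ P⁺ b ⊗ A⁺
    P⁺A⁺-sym zero    zero    = refl
    P⁺A⁺-sym zero    (suc k) = begin
      P⁺ b (suc k) ∙ a          ≡⟨ row k a ⟩
      d k - d k * b ∙ a         ≡⟨ solve 2 (λ d t → d :- d :* t := (con 1ℚ :- t) :* d) refl (d k) (b ∙ a) ⟩
      (1ℚ - b ∙ a) * d k        ≡⟨ bA k ⟨
      (b ⊙ A) k                 ∎
    P⁺A⁺-sym (suc k) zero    = sym (P⁺A⁺-sym zero (suc k))
    P⁺A⁺-sym (suc k) (suc l) = begin
      P⁺ b (suc l) ∙ (A ᵀ) k                        ≡⟨ row l ((A ᵀ) k) ⟩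
      (P ⊗ A) l k - d l * (b ⊙ A) k                 ≡⟨ cong (λ t → (P ⊗ A) l k - d l * t) (bA k) ⟩
      (P ⊗ A) l k - d l * ((1ℚ - b ∙ a) * d k)      ≡⟨ cong₂ _-_ (PA-sym k l) (solve 3 (λ x y t → x :* (t :* y) := y :* (t :* x)) refl (d l) (d k) (1ℚ - b ∙ a)) ⟩
      (P ⊗ A) k l - d k * ((1ℚ - b ∙ a) * d l)      ≡⟨ cong (λ t → (P ⊗ A) k l - d k * t) (bA l) ⟨
      (P ⊗ A) k l - d k * (b ⊙ A) l                 ≡⟨ row k ((A ᵀ) l) ⟨
      P⁺ b (suc k) ∙ (A ᵀ) l                        ∎

    isMoorePenrose : IsMoorePenrose A⁺ (P⁺ b)
    isMoorePenrose = record { APA≐A = apa ; PAP≐P = pap ; AP-sym = aps ; PA-sym = P⁺A⁺-sym }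
      where
      apa : A⁺ ⊗ P⁺ b ⊗ A⁺ ≐ A⁺
      apa i zero = begin
        (A⁺ ⊗ P⁺ b) i ∙ a                      ≡⟨ AP+cb i a ⟩
        (A ⊗ P) i ∙ a + c i * b ∙ a            ≡⟨ cong₂ _+_ (∙-assoc (A i) P a) (cba i) ⟩
        (A ⊛ d) i + (a i - (A ⊛ d) i)          ≡⟨ solve 2 (λ x y → x :+ (y :- x) := y) refl ((A ⊛ d) i) (a i) ⟩
        a i                                    ∎
      apa i (suc j) = begin
        (A⁺ ⊗ P⁺ b) i ∙ (A ᵀ) j                ≡⟨ AP+cb i ((A ᵀ) j) ⟩
        (A ⊗ P ⊗ A) i j + c i * (b ⊙ A) j      ≡⟨ cong₂ _+_ (APA≐A i j) (cbA i j) ⟩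
        A i j + 0ℚ                             ≡⟨ ℚ.+-identityʳ (A i j) ⟩
        A i j                                  ∎

      aps : (A⁺ ⊗ P⁺ b) ᵀ ≐ A⁺ ⊗ P⁺ b
      aps i j = begin
        (A⁺ ⊗ P⁺ b) j i             ≡⟨ A⁺P⁺ j i ⟩
        (A ⊗ P) j i + c j * b i     ≡⟨ cong₂ _+_ (AP-sym i j) (cb-sym j i) ⟩
        (A ⊗ P) i j + c i * b j     ≡⟨ A⁺P⁺ i j ⟨
        (A⁺ ⊗ P⁺ b) i j             ∎

      pap : P⁺ b ⊗ A⁺ ⊗ P⁺ b ≐ P⁺ b
      pap zero    j = trans (⊗-assoc (P⁺ b) A⁺ (P⁺ b) zero j) (row₀ j)
      pap (suc k) j = begin
        (P⁺ b ⊗ A⁺ ⊗ P⁺ b) (suc k) j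
          ≡⟨ ⊗-assoc (P⁺ b) A⁺ (P⁺ b) (suc k) j ⟩
        P⁺ b (suc k) ∙ ((A⁺ ⊗ P⁺ b) ᵀ) j
          ≡⟨ row k (((A⁺ ⊗ P⁺ b) ᵀ) j) ⟩
        P k ∙ ((A⁺ ⊗ P⁺ b) ᵀ) j - d k * b ∙ ((A⁺ ⊗ P⁺ b) ᵀ) j
          ≡⟨ cong₂ (λ s t → s - d k * t) PAP (row₀ j) ⟩
        P k j - d k * b j
          ∎
        where
        PAP : P k ∙ ((A⁺ ⊗ P⁺ b) ᵀ) j ≡ P k j
        PAP = begin
          P k ∙ ((A⁺ ⊗ P⁺ b) ᵀ) j                   ≡⟨ ∙-cong {u = P k} (λ _ → refl) (λ i → A⁺P⁺ i j) ⟩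
          P k ∙ (λ i → (A ⊗ P) i j + c i * b j)     ≡⟨ split (P k) (((A ⊗ P) ᵀ) j) c (b j) ⟩
          (P ⊗ (A ⊗ P)) k j + (P ⊛ c) k * b j       ≡⟨ cong₂ (λ s t → s + t * b j) (sym (⊗-assoc P A P k j)) (Pc≡0 k) ⟩
          (P ⊗ A ⊗ P) k j + 0ℚ * b j                ≡⟨ cong₂ _+_ (PAP≐P k j) (ℚ.*-zeroˡ (b j)) ⟩
          P k j + 0ℚ                                ≡⟨ ℚ.+-identityʳ (P k j) ⟩
          P k j                                     ∎

  module Independent (s≢0 : c ∙ c ≢ 0ℚ) where

    private instance _ = ≢-nonZero s≢0

    s⁻¹ : ℚ
    s⁻¹ = 1/ (c ∙ c)

    b : Vector ℚ m
    b i = s⁻¹ * c i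

    b∙ : ∀ v → b ∙ v ≡ s⁻¹ * c ∙ v
    b∙ v = begin
      b ∙ v              ≡⟨ ∙-comm b v ⟩
      v ∙ b              ≡⟨ ∙-*ˡ v c s⁻¹ ⟩
      s⁻¹ * v ∙ c        ≡⟨ cong (s⁻¹ *_) (∙-comm v c) ⟩
      s⁻¹ * c ∙ v        ∎

    b∙c≡1 : b ∙ c ≡ 1ℚ
    b∙c≡1 = trans (b∙ c) (ℚ.*-inverseˡ (c ∙ c))

    bA≡0 : ∀ j → (b ⊙ A) j ≡ 0ℚ
    bA≡0 j = trans (b∙ ((A ᵀ) j)) (trans (cong (s⁻¹ *_) (cA≡0 j)) (ℚ.*-zeroʳ s⁻¹))

    b∙a≡1 : b ∙ a ≡ 1ℚ
    b∙a≡1 = begin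
      b ∙ a                            ≡⟨ solve 2 (λ x y → x := x :- y :+ y) refl (b ∙ a) (b ∙ (A ⊛ d)) ⟩
      b ∙ a - b ∙ (A ⊛ d) + b ∙ (A ⊛ d) ≡⟨ cong₂ _+_ (sym (∙-distribˡ-- b a (A ⊛ d))) bAd ⟩
      b ∙ c + 0ℚ                       ≡⟨ ℚ.+-identityʳ (b ∙ c) ⟩
      b ∙ c                            ≡⟨ b∙c≡1 ⟩
      1ℚ                               ∎
      where
      bAd : b ∙ (A ⊛ d) ≡ 0ℚ
      bAd = begin
        b ∙ (A ⊛ d)          ≡⟨ ∙-assoc b A d ⟨
        (b ⊙ A) ∙ d          ≡⟨ ∙-cong {v = d} bA≡0 (λ _ → refl) ⟩
        (λ _ → 0ℚ) ∙ d       ≡⟨ ∙-comm (λ _ → 0ℚ) d ⟩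
        d ∙ (λ _ → 0ℚ)       ≡⟨ ∙-zeroʳ d ⟩
        0ℚ                   ∎

    result : IsMoorePenrose A⁺ (P⁺ b)
    result = isMoorePenrose b
      (λ i j → solve 3 (λ s x y → x :* (s :* y) := y :* (s :* x)) refl s⁻¹ (c i) (c j))
      (λ i j → trans (cong (c i *_) (bA≡0 j)) (ℚ.*-zeroʳ (c i)))
      (λ i → trans (cong (c i *_) b∙a≡1) (ℚ.*-identityʳ (c i)))
      (λ j → begin
        (b ⊙ A) j                  ≡⟨ bA≡0 j ⟩
        0ℚ                         ≡⟨ ℚ.*-zeroˡ (d j) ⟨
        (1ℚ - 1ℚ) * d j            ≡⟨ cong (λ t → (1ℚ - t) * d j) b∙a≡1 ⟨
        (1ℚ - b ∙ a) * d j         ∎)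
      (λ j → begin
        b ∙ ((A ⊗ P) ᵀ) j + b ∙ c * b j   ≡⟨ cong₂ (λ s t → s + t * b j) (bAP≡0 j) b∙c≡1 ⟩
        0ℚ + 1ℚ * b j                     ≡⟨ solve 1 (λ x → con 0ℚ :+ con 1ℚ :* x := x) refl (b j) ⟩
        b j                               ∎)
      where
      bAP≡0 : ∀ j → b ∙ ((A ⊗ P) ᵀ) j ≡ 0ℚ
      bAP≡0 j = begin
        b ∙ (A ⊛ (P ᵀ) j)            ≡⟨ ∙-assoc b A ((P ᵀ) j) ⟨
        (b ⊙ A) ∙ (P ᵀ) j            ≡⟨ ∙-cong {v = (P ᵀ) j} bA≡0 (λ _ → refl) ⟩
        (λ _ → 0ℚ) ∙ (P ᵀ) j         ≡⟨ ∙-comm (λ _ → 0ℚ) ((P ᵀ) j) ⟩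
        (P ᵀ) j ∙ (λ _ → 0ℚ)         ≡⟨ ∙-zeroʳ ((P ᵀ) j) ⟩
        0ℚ                           ∎

  module Dependent (s≡0 : c ∙ c ≡ 0ℚ) where

    t : ℚ
    t = 1ℚ + d ∙ d

    t≢0 : t ≢ 0ℚ
    t≢0 t≡0 = ℚ.<⇒≢ (ℚ.<-≤-trans (ℚ.positive⁻¹ 1ℚ)
      (subst (_≤ t) (ℚ.+-identityʳ 1ℚ) (ℚ.+-monoʳ-≤ 1ℚ (∙-nonNeg d)))) (sym t≡0)

    private instance _ = ≢-nonZero t≢0

    t⁻¹ : ℚ
    t⁻¹ = 1/ t

    b : Vector ℚ m
    b i = t⁻¹ * (d ⊙ P) i

    c≡0 : ∀ i → c i ≡ 0ℚ
    c≡0 = ∙-definite c s≡0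

    b∙ : ∀ v → b ∙ v ≡ t⁻¹ * d ∙ (P ⊛ v)
    b∙ v = begin
      b ∙ v                  ≡⟨ ∙-comm b v ⟩
      v ∙ b                  ≡⟨ ∙-*ˡ v (d ⊙ P) t⁻¹ ⟩
      t⁻¹ * v ∙ (d ⊙ P)      ≡⟨ cong (t⁻¹ *_) (∙-comm v (d ⊙ P)) ⟩
      t⁻¹ * (d ⊙ P) ∙ v      ≡⟨ cong (t⁻¹ *_) (∙-assoc d P v) ⟩
      t⁻¹ * d ∙ (P ⊛ v)      ∎

    1-b∙a : 1ℚ - b ∙ a ≡ t⁻¹
    1-b∙a = begin
      1ℚ - b ∙ a                       ≡⟨ cong₂ _-_ (sym (ℚ.*-inverseˡ t)) (b∙ a) ⟩
      t⁻¹ * (1ℚ + d ∙ d) - t⁻¹ * d ∙ d ≡⟨ solve 2 (λ i x → i :* (con 1ℚ :+ x) :- i :* x := i) refl t⁻¹ (d ∙ d) ⟩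
      t⁻¹                              ∎

    bA≡ : ∀ j → (b ⊙ A) j ≡ t⁻¹ * d j
    bA≡ j = begin
      b ∙ (A ᵀ) j                     ≡⟨ b∙ ((A ᵀ) j) ⟩
      t⁻¹ * d ∙ (λ k → (P ⊗ A) k j)   ≡⟨ cong (t⁻¹ *_) (∙-cong {u = d} (λ _ → refl) (PA-sym j)) ⟩
      t⁻¹ * d ∙ (P ⊗ A) j             ≡⟨ cong (t⁻¹ *_) (∙-comm d ((P ⊗ A) j)) ⟩
      t⁻¹ * (P ⊗ A) j ∙ d             ≡⟨ cong (t⁻¹ *_) (PAd≡d j) ⟩
      t⁻¹ * d j                       ∎

    result : IsMoorePenrose A⁺ (P⁺ b)
    result = isMoorePenrose b
      (λ i j → trans (c0 i (b j)) (sym (c0 j (b i))))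
      (λ i j → c0 i ((b ⊙ A) j))
      (λ i → trans (c0 i (b ∙ a)) (sym (c≡0 i)))
      (λ j → trans (bA≡ j) (cong (_* d j) (sym 1-b∙a)))
      (λ j → begin
        b ∙ ((A ⊗ P) ᵀ) j + b ∙ c * b j    ≡⟨ cong₂ (λ x y → x + y * b j) (bAP≡ j) b∙c≡0 ⟩
        b j + 0ℚ * b j                     ≡⟨ solve 1 (λ x → x :+ con 0ℚ :* x := x) refl (b j) ⟩
        b j                                ∎)
      where
      c0 : ∀ i x → c i * x ≡ 0ℚ
      c0 i x = trans (cong (_* x) (c≡0 i)) (ℚ.*-zeroˡ x)
      b∙c≡0 : b ∙ c ≡ 0ℚ
      b∙c≡0 = trans (∙-cong {u = b} (λ _ → refl) c≡0) (∙-zeroʳ b)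
      bAP≡ : ∀ j → b ∙ ((A ⊗ P) ᵀ) j ≡ b j
      bAP≡ j = begin
        b ∙ (A ⊛ (P ᵀ) j)               ≡⟨ ∙-assoc b A ((P ᵀ) j) ⟨
        (b ⊙ A) ∙ (P ᵀ) j               ≡⟨ ∙-cong {v = (P ᵀ) j} bA≡ (λ _ → refl) ⟩
        (λ k → t⁻¹ * d k) ∙ (P ᵀ) j     ≡⟨ ∙-comm _ ((P ᵀ) j) ⟩
        (P ᵀ) j ∙ (λ k → t⁻¹ * d k)     ≡⟨ ∙-*ˡ ((P ᵀ) j) d t⁻¹ ⟩
        t⁻¹ * (P ᵀ) j ∙ d               ≡⟨ cong (t⁻¹ *_) (∙-comm ((P ᵀ) j) d) ⟩
        b j                             ∎

  step : ∃ (IsMoorePenrose A⁺)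
  step with c ∙ c ℚ.≟ 0ℚ
  ... | yes s≡0 = _ , Dependent.result s≡0
  ... | no  s≢0 = _ , Independent.result s≢0

IsMoorePenrose-cong : {A A′ : Matrix m n} {P : Matrix n m} → A ≐ A′ →
                      IsMoorePenrose A P → IsMoorePenrose A′ P
IsMoorePenrose-cong {A = A} {A′} {P} eq mp = record
  { APA≐A  = λ i j → trans (sym (∙-cong (AP i) (λ k → eq k j))) (trans (APA≐A i j) (eq i j))
  ; PAP≐P  = λ i j → trans (sym (∙-cong {v = (P ᵀ) j} (PA i) (λ _ → refl))) (PAP≐P i j)
  ; AP-sym = λ i j → trans (sym (AP j i)) (trans (AP-sym i j) (AP i j))
  ; PA-sym = λ i j → trans (sym (PA j i)) (trans (PA-sym i j) (PA i j))
  }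
  where
  open IsMoorePenrose mp
  AP : A ⊗ P ≐ A′ ⊗ P
  AP i j = ∙-cong {v = (P ᵀ) j} (eq i) (λ _ → refl)
  PA : P ⊗ A ≐ P ⊗ A′
  PA i j = ∙-cong {u = P i} (λ _ → refl) (λ k → eq k j)

moorePenrose : (A : Matrix m n) → ∃ (IsMoorePenrose A)
moorePenrose {n = zero} A = (λ ()) , record
  { APA≐A = λ _ () ; PAP≐P = λ () ; AP-sym = λ _ _ → refl ; PA-sym = λ () }
moorePenrose {n = suc n} A =
  let P  , mp  = moorePenrose (λ i j → A i (suc j))
      P′ , mp′ = Greville.step _ P mp (λ i → A i zero)
  in  P′ , IsMoorePenrose-cong (λ { i zero → refl ; i (suc j) → refl }) mp′

_† : Matrix m n → Matrix n m
A † = proj₁ (moorePenrose A)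

†-isMoorePenrose : (A : Matrix m n) → IsMoorePenrose A (A †)
†-isMoorePenrose A = proj₂ (moorePenrose A)

moorePenrose-unique : (A : Matrix m n) {P Q : Matrix n m} →
                      IsMoorePenrose A P → IsMoorePenrose A Q → P ≐ Q
moorePenrose-unique A {P} {Q} mpP mpQ i j = begin
  P i j                  ≡⟨ P.PAP≐P i j ⟨
  (P ⊗ A ⊗ P) i j        ≡⟨ ∙-cong {v = (P ᵀ) j} (PA≐QA i) (λ _ → refl) ⟩
  (Q ⊗ A ⊗ P) i j        ≡⟨ ⊗-assoc Q A P i j ⟩
  (Q ⊗ (A ⊗ P)) i j      ≡⟨ ∙-cong {u = Q i} (λ _ → refl) (λ k → AP≐AQ k j) ⟩
  (Q ⊗ (A ⊗ Q)) i j      ≡⟨ ⊗-assoc Q A Q i j ⟨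
  (Q ⊗ A ⊗ Q) i j        ≡⟨ Q.PAP≐P i j ⟩
  Q i j                  ∎
  where
  module P = IsMoorePenrose mpP
  module Q = IsMoorePenrose mpQ
  AP≐AQ : A ⊗ P ≐ A ⊗ Q
  AP≐AQ i j = begin
    (A ⊗ P) i j                  ≡⟨ ∙-cong {v = (P ᵀ) j} (Q.APA≐A i) (λ _ → refl) ⟨
    (A ⊗ Q ⊗ A ⊗ P) i j          ≡⟨ ⊗-assoc (A ⊗ Q) A P i j ⟩
    (A ⊗ Q) i ∙ ((A ⊗ P) ᵀ) j    ≡⟨ ∙-cong (λ k → Q.AP-sym k i) (P.AP-sym j) ⟩
    ((A ⊗ Q) ᵀ) i ∙ (A ⊗ P) j    ≡⟨ ∙-comm (((A ⊗ Q) ᵀ) i) ((A ⊗ P) j) ⟩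
    (A ⊗ P ⊗ (A ⊗ Q)) j i        ≡⟨ ⊗-assoc (A ⊗ P) A Q j i ⟨
    (A ⊗ P ⊗ A ⊗ Q) j i          ≡⟨ ∙-cong {v = (Q ᵀ) i} (P.APA≐A j) (λ _ → refl) ⟩
    (A ⊗ Q) j i                  ≡⟨ Q.AP-sym i j ⟩
    (A ⊗ Q) i j                  ∎
  PA≐QA : P ⊗ A ≐ Q ⊗ A
  PA≐QA i j = begin
    (P ⊗ A) i j                  ≡⟨ ∙-cong {u = P i} (λ _ → refl) (λ k → Q.APA≐A k j) ⟨
    (P ⊗ (A ⊗ Q ⊗ A)) i j        ≡⟨ ∙-cong {u = P i} (λ _ → refl) (λ k → ⊗-assoc A Q A k j) ⟩
    (P ⊗ (A ⊗ (Q ⊗ A))) i j      ≡⟨ ⊗-assoc P A (Q ⊗ A) i j ⟨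
    (P ⊗ A) i ∙ ((Q ⊗ A) ᵀ) j    ≡⟨ ∙-cong (λ k → P.PA-sym k i) (Q.PA-sym j) ⟩
    ((P ⊗ A) ᵀ) i ∙ (Q ⊗ A) j    ≡⟨ ∙-comm (((P ⊗ A) ᵀ) i) ((Q ⊗ A) j) ⟩
    (Q ⊗ A ⊗ (P ⊗ A)) j i        ≡⟨ ⊗-assoc Q A (P ⊗ A) j i ⟩
    (Q ⊗ (A ⊗ (P ⊗ A))) j i      ≡⟨ ∙-cong {u = Q j} (λ _ → refl) (λ k → ⊗-assoc A P A k i) ⟨
    (Q ⊗ (A ⊗ P ⊗ A)) j i        ≡⟨ ∙-cong {u = Q j} (λ _ → refl) (λ k → P.APA≐A k i) ⟩
    (Q ⊗ A) j i                  ≡⟨ Q.PA-sym i j ⟩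
    (Q ⊗ A) i j                  ∎

record Graph (N : ℕ) : Set₁ where
  field
    Adj        : Rel (Fin N) 0ℓ
    adj?       : Decidable Adj
    adj-sym    : Symmetric Adj
    adj-irrefl : Irreflexive _≡_ Adj

Connected : Graph N → Set
Connected G = ∀ u v → Star (Graph.Adj G) u v

module _ {N : ℕ} (G : Graph N) where

  open Graph G

  adjacency : Matrix N N
  adjacency i j = if does (adj? i j) then 1ℚ else 0ℚ

  degree : Vector ℚ N
  degree i = ∑[ j < N ] adjacency i j

  laplacian : Matrix N N
  laplacian i j = (if does (i Fin.≟ j) then degree i else 0ℚ) - adjacency i j

  𝐞 : Fin N → Vector ℚ N
  𝐞 i k = if does (i Fin.≟ k) then 1ℚ else 0ℚ

  resistance : Fin N → Fin N → ℚ
  resistance i j = 𝐞ᵢ-𝐞ⱼ ∙ (laplacian † ⊛ 𝐞ᵢ-𝐞ⱼ)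
    where
    𝐞ᵢ-𝐞ⱼ : Vector ℚ N
    𝐞ᵢ-𝐞ⱼ k = 𝐞 i k - 𝐞 j k

  resistances : List ℚ
  resistances = cartesianProductWith resistance (allFin N) (allFin N)

  -- The seed 0 of max is itself a resistance as soon as there is a vertex.

  maxResistance : ℚ
  maxResistance = max 0ℚ resistances

  resistance-self : ∀ i → resistance i i ≡ 0ℚ
  resistance-self i = begin
    z ∙ w              ≡⟨ ∙-cong {v = w} (λ k → ℚ.+-inverseʳ (𝐞 i k)) (λ _ → refl) ⟩
    (λ _ → 0ℚ) ∙ w     ≡⟨ ∙-comm (λ _ → 0ℚ) w ⟩
    w ∙ (λ _ → 0ℚ)     ≡⟨ ∙-zeroʳ w ⟩
    0ℚ                 ∎
    where
    z w : Vector ℚ N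
    z k = 𝐞 i k - 𝐞 i k
    w = laplacian † ⊛ z

  resistance≤maxResistance : ∀ u v → resistance u v ≤ maxResistance
  resistance≤maxResistance u v = All.lookup (xs≤max 0ℚ resistances)
    (∈-cartesianProductWith⁺ resistance (∈-allFin u) (∈-allFin v))

  maxResistance-attained : Fin N → ∃₂ λ u v → resistance u v ≡ maxResistance
  maxResistance-attained u with argmax-sel (λ q → q) 0ℚ resistances
  ... | inj₁ eq = u , u , trans (resistance-self u) (sym eq)
  ... | inj₂ r∈ with ∈-cartesianProductWith⁻ resistance (allFin N) (allFin N) r∈
  ...   | u′ , v′ , _ , _ , eq = u′ , v′ , sym eq

next : .{{_ : NonZero n}} → Fin n → Fin n
next {n} i = suc (toℕ i) mod n

next≢ : .{{_ : NonZero n}} → 2 ℕ.≤ n → (i : Fin n) → next i ≢ i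
next≢ {n} 2≤n i eq with ℕ.m≤n⇒m<n∨m≡n (toℕ<n i)
... | inj₁ 1+i<n = ℕ.1+n≢n (trans (sym (m<n⇒m%n≡m 1+i<n)) toℕ-eq)
  where
  toℕ-eq : suc (toℕ i) % n ≡ toℕ i
  toℕ-eq = trans (sym (toℕ-fromℕ< (m%n<n (suc (toℕ i)) n))) (cong toℕ eq)
... | inj₂ 1+i≡n = ℕ.<⇒≢ 2≤n (trans (cong suc (sym i≡0)) 1+i≡n)
  where
  i≡0 : toℕ i ≡ 0
  i≡0 = begin
    toℕ i              ≡⟨ cong toℕ eq ⟨
    toℕ (next i)       ≡⟨ toℕ-fromℕ< (m%n<n (suc (toℕ i)) n) ⟩
    suc (toℕ i) % n    ≡⟨ cong (_% n) 1+i≡n ⟩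
    n % n              ≡⟨ n%n≡0 n ⟩
    0                  ∎

-- Every vertex of the flower has exactly one representative (i , v) with
-- v ≢ y, since yᵢ is identified with x in petal i + 1.  Hence Fin (n * m)
-- serves as the vertex set, and π is the quotient map from the disjoint
-- union of the petals, whose kernel is the equivalence generated by Glue.

module _ {m : ℕ} (G : Graph (suc m)) {x y : Fin (suc m)} (x≢y : x ≢ y)
         (n : ℕ) (3≤n : 3 ℕ.≤ n) where

  open Graph G

  private instance
    n≢0 : NonZero n
    n≢0 = >-nonZero (ℕ.≤-trans (s≤s z≤n) 3≤n)

  π : Fin n → Fin (suc m) → Fin (n ℕ.* m)
  π i v with y Fin.≟ v
  ... | yes _   = combine (next i) (punchOut (x≢y ∘ sym))
  ... | no  y≢v = combine i (punchOut y≢v)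

  data Glue : Rel (Fin n × Fin (suc m)) 0ℓ where
    glue : ∀ i → Glue (i , y) (next i , x)

  π-glue : ∀ i → π i y ≡ π (next i) x
  π-glue i with y Fin.≟ y | y Fin.≟ x
  ... | no  y≢y | _       = ⊥-elim (y≢y refl)
  ... | yes _   | yes y≡x = ⊥-elim (x≢y (sym y≡x))
  ... | yes _   | no  _   = cong (combine (next i)) (punchOut-cong y refl)

  π-sound : ∀ {p q} → EqClosure Glue p q → uncurry π p ≡ uncurry π q
  π-sound = gfold isEquivalence (uncurry π) λ { (glue i) → π-glue i }

  private
    combine-punchOut : ∀ {i j : Fin n} {u v : Fin (suc m)} (y≢u : y ≢ u) (y≢v : y ≢ v) →
                       combine i (punchOut y≢u) ≡ combine j (punchOut y≢v) → (i , u) ≡ (j , v)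
    combine-punchOut {i} {j} y≢u y≢v eq with combine-injective i _ j _ eq
    ... | i≡j , eq′ = cong₂ _,_ i≡j (punchOut-injective y≢u y≢v eq′)

    ≡⇒∼ : ∀ {p q} → p ≡ q → EqClosure Glue p q
    ≡⇒∼ refl = ε

  π-complete : ∀ p q → uncurry π p ≡ uncurry π q → EqClosure Glue p q
  π-complete (i , u) (j , v) eq with y Fin.≟ u | y Fin.≟ v
  ... | yes refl | yes refl =
    return (glue i) ◅◅ ≡⇒∼ (combine-punchOut _ _ eq) ◅◅ symmetric _ (return (glue j))
  ... | yes refl | no  y≢v  = return (glue i) ◅◅ ≡⇒∼ (combine-punchOut _ y≢v eq)
  ... | no  y≢u  | yes refl = ≡⇒∼ (combine-punchOut y≢u _ eq) ◅◅ symmetric _ (return (glue j))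
  ... | no  y≢u  | no  y≢v  = ≡⇒∼ (combine-punchOut y≢u y≢v eq)

  π-surjective : ∀ w → ∃₂ λ i v → π i v ≡ w
  π-surjective w = let i , k = remQuot m w in i , punchIn y k , trans (π-punchIn i k) (combine-remQuot {n} m w)
    where
    π-punchIn : ∀ i k → π i (punchIn y k) ≡ combine i k
    π-punchIn i k with y Fin.≟ punchIn y k
    ... | yes y≡ = ⊥-elim (punchInᵢ≢i y k (sym y≡))
    ... | no  y≢ = cong (combine i) (trans (punchOut-cong y refl) (punchOut-punchIn y))

  FlowerAdj : Rel (Fin (n ℕ.* m)) 0ℓ
  FlowerAdj u w = ∃ λ i → ∃₂ λ a b → Adj a b × π i a ≡ u × π i b ≡ w

  π-petal-injective : ∀ i {a b} → π i a ≡ π i b → a ≡ b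
  π-petal-injective i {a} {b} eq with y Fin.≟ a | y Fin.≟ b
  ... | yes refl | yes refl = refl
  ... | yes refl | no  y≢b  = ⊥-elim (next≢ (ℕ.<⇒≤ 3≤n) i (proj₁ (combine-injective _ _ _ _ eq)))
  ... | no  y≢a  | yes refl = ⊥-elim (next≢ (ℕ.<⇒≤ 3≤n) i (sym (proj₁ (combine-injective _ _ _ _ eq))))
  ... | no  y≢a  | no  y≢b  = punchOut-injective y≢a y≢b (proj₂ (combine-injective i _ i _ eq))

  flower : Graph (n ℕ.* m)
  flower = record
    { Adj        = FlowerAdj
    ; adj?       = λ u w → any? λ i → any? λ a → any? λ b →
                     adj? a b ×-dec π i a Fin.≟ u ×-dec π i b Fin.≟ w
    ; adj-sym    = λ (i , a , b , ab , p , q) → i , b , a , adj-sym ab , q , p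
    ; adj-irrefl = λ { refl (i , a , b , ab , p , q) →
                     adj-irrefl (π-petal-injective i (trans p (sym q))) ab }
    }

{-# OPTIONS --safe #-}

-- By the Dirichlet principle, r(u,v) ≥ 2 (f u - f v) - fᵀ L f for every f on
-- the vertices.  Let f depend only on the petal, growing by t per petal on the
-- way from v = x₀ to the antipodal u and then decreasing again.  Each petal
-- contributes at most a constant multiple of t² to the energy, so for small
-- fixed t the gap f u - f v, linear in n, dominates the energy, also linear in n.

module Submission where

open import Defs
open import Algebra.Bundles using (CommutativeRing)
open import Data.Bool.Base using (if_then_else_)
open import Data.Empty using (⊥-elim)
open import Data.Fin.Base using (Fin; zero; suc; toℕ; fromℕ<; inject₁; remQuot)
open import Data.Fin.Induction using (<-weakInduction)
open import Data.Fin.Properties as Fin using (toℕ<n; toℕ-fromℕ<; toℕ-inject₁; toℕ-injective; remQuot-combine)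
open import Data.Integer.Base as ℤ using (-[1+_])
import Data.Integer.Properties as ℤ
open import Data.Nat.Base as ℕ using (ℕ; zero; suc; _≤_; _∸_; _⊓_; ⌊_/2⌋; s≤s; z≤n; NonZero; >-nonZero)
open import Data.Nat.DivMod using (_%_; m<n⇒m%n≡m; n%n≡0; m%n<n)
import Data.Nat.Properties as ℕ
open import Data.Product.Base using (∃-syntax; _×_; _,_; proj₁)
open import Data.Rational.Base as ℚ
  using (ℚ; 0ℚ; 1ℚ; _+_; _-_; _*_; -_; 1/_; _<_; mkℚ; toℚᵘ; Positive; nonNegative; positive) renaming (_≤_ to _≤ℚ_)
import Data.Rational.Properties as ℚ
open import Data.Rational.Unnormalised.Base as ℚᵘ using (mkℚᵘ; _≃_; *≡*; *<*)
import Data.Rational.Unnormalised.Properties as ℚᵘ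
open import Data.Rational.Solver using (module +-*-Solver)
open import Data.Sum.Base using (_⊎_; inj₁; inj₂)
open import Data.Vec.Functional using (Vector)
open import Function.Base using (_∘_)
open import Relation.Binary.Construct.Closure.ReflexiveTransitive using (Star; ε; _◅_; _◅◅_; gmap; reverse)
open import Relation.Binary.PropositionalEquality
open import Relation.Nullary.Decidable using (yes; no; does)
open import Relation.Nullary.Negation using (contradiction)

open import Algebra.Properties.Semiring.Mult (CommutativeRing.semiring ℚ.+-*-commutativeRing)
  using (×-homo-+; ×-assoc-*) renaming (_×_ to _·_)
open import Algebra.Properties.Semiring.Sum (CommutativeRing.semiring ℚ.+-*-commutativeRing)
  using (sum-replicate)
open +-*-Solver using (solve; _:=_; _:+_; _:*_; _:-_; con)
open ≡-Reasoning

private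
  variable
    n k : ℕ

-- Inequalities in ℚ, natural multiples, and the archimedean property.

*-nonNeg : ∀ {p q} → 0ℚ ≤ℚ p → 0ℚ ≤ℚ q → 0ℚ ≤ℚ p * q
*-nonNeg {p} {q} 0≤p 0≤q =
  subst (_≤ℚ p * q) (ℚ.*-zeroʳ p) (ℚ.*-monoˡ-≤-nonNeg p {{nonNegative 0≤p}} 0≤q)

1≤p⇒q≤p*q : ∀ {p q} → 1ℚ ≤ℚ p → 0ℚ ≤ℚ q → q ≤ℚ p * q
1≤p⇒q≤p*q {p} {q} 1≤p 0≤q =
  subst (_≤ℚ p * q) (ℚ.*-identityˡ q) (ℚ.*-monoʳ-≤-nonNeg q {{nonNegative 0≤q}} 1≤p)

0≤q-p⇒p≤q : ∀ {p q} → 0ℚ ≤ℚ q - p → p ≤ℚ q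
0≤q-p⇒p≤q {p} {q} 0≤q-p = subst₂ _≤ℚ_ (ℚ.+-identityʳ p)
  (solve 2 (λ p q → p :+ (q :- p) := q) refl p q) (ℚ.+-monoʳ-≤ p 0≤q-p)

p≤q⇒0≤q-p : ∀ {p q} → p ≤ℚ q → 0ℚ ≤ℚ q - p
p≤q⇒0≤q-p {p} {q} p≤q = subst (_≤ℚ q - p) (ℚ.+-inverseʳ p) (ℚ.+-monoˡ-≤ (- p) p≤q)

-- The difference t² - (p - q)² factors as (t + q - p)(t + p - q), and the two hypotheses make both
-- factors nonnegative. This bounds the square without absolute values.
square-bounded : ∀ {p q t} → p ≤ℚ t + q → q ≤ℚ t + p → (p - q) * (p - q) ≤ℚ t * t
square-bounded {p} {q} {t} p≤t+q q≤t+p = 0≤q-p⇒p≤q (subst (0ℚ ≤ℚ_)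
  (solve 3 (λ p q t → (t :+ q :- p) :* (t :+ p :- q) := t :* t :- (p :- q) :* (p :- q)) refl p q t)
  (*-nonNeg (p≤q⇒0≤q-p p≤t+q) (p≤q⇒0≤q-p q≤t+p)))

·-nonNeg : ∀ k {t} → 0ℚ ≤ℚ t → 0ℚ ≤ℚ k · t
·-nonNeg zero    0≤t = ℚ.≤-refl
·-nonNeg (suc k) 0≤t = ℚ.+-mono-≤ 0≤t (·-nonNeg k 0≤t)

·-monoˡ-≤ : ∀ {t} → 0ℚ ≤ℚ t → ∀ {j k} → j ≤ k → j · t ≤ℚ k · t
·-monoˡ-≤ 0≤t {k = k} z≤n = ·-nonNeg k 0≤t
·-monoˡ-≤ {t} 0≤t (s≤s j≤k) = ℚ.+-monoʳ-≤ t (·-monoˡ-≤ 0≤t j≤k)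

·-monoʳ-≤ : ∀ k {p q} → p ≤ℚ q → k · p ≤ℚ k · q
·-monoʳ-≤ zero    p≤q = ℚ.≤-refl
·-monoʳ-≤ (suc k) p≤q = ℚ.+-mono-≤ p≤q (·-monoʳ-≤ k p≤q)

·-pos : ∀ k {p} → 0ℚ < p → 0ℚ < suc k · p
·-pos k {p} 0<p = subst (_< suc k · p) (ℚ.+-identityʳ 0ℚ) (ℚ.+-mono-<-≤ 0<p (·-nonNeg k (ℚ.<⇒≤ 0<p)))

-- Passing to unnormalised rationals avoids reduction to lowest terms, so that the comparison in
-- `archimedean` becomes one between integers.
toℚᵘ-·1 : ∀ k → toℚᵘ (k · 1ℚ) ≃ mkℚᵘ (ℤ.+ k) 0
toℚᵘ-·1 zero    = ℚᵘ.≃-refl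
toℚᵘ-·1 (suc k) = ℚᵘ.≃-trans (ℚ.toℚᵘ-homo-+ 1ℚ (k · 1ℚ))
  (ℚᵘ.≃-trans (ℚᵘ.+-congʳ (toℚᵘ 1ℚ) (toℚᵘ-·1 k))
              (*≡* (cong (λ z → (ℤ.+ 1 ℤ.+ z) ℤ.* ℤ.+ 1) (ℤ.*-identityʳ (ℤ.+ k)))))

archimedean : ∀ p → ∃[ k ] p < k · 1ℚ
-- A denominator is at least 1, so p is at most the absolute value of its numerator; adding 1 makes
-- the inequality strict.
archimedean p@(mkℚ z d-1 _) = suc ℤ.∣ z ∣ ,
  ℚ.toℚᵘ-cancel-< (ℚᵘ.<-respʳ-≃ (ℚᵘ.≃-sym (toℚᵘ-·1 (suc ℤ.∣ z ∣))) (*<* (numerator z)))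
  where
  numerator : ∀ z → z ℤ.* ℤ.+ 1 ℤ.< ℤ.+ suc ℤ.∣ z ∣ ℤ.* ℤ.+ suc d-1
  numerator z@(ℤ.+ a)  = subst₂ ℤ._<_ (sym (ℤ.*-identityʳ z)) (ℤ.pos-* (suc a) (suc d-1))
    (ℤ.+<+ (ℕ.m≤m*n (suc a) (suc d-1)))
  numerator z@(-[1+ _ ]) = ℤ.-<+

-- Estimates for finite sums.

sum-mono-≤ : {f g : Vector ℚ n} → (∀ i → f i ≤ℚ g i) → sum f ≤ℚ sum g
sum-mono-≤ {zero}  f≤g = ℚ.≤-refl
sum-mono-≤ {suc n} f≤g = ℚ.+-mono-≤ (f≤g zero) (sum-mono-≤ (f≤g ∘ suc))

sum-bounded : {f : Vector ℚ n} {c : ℚ} → (∀ i → f i ≤ℚ c) → sum f ≤ℚ n · c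
sum-bounded {n} {f} f≤c = subst (sum f ≤ℚ_) (sum-replicate n) (sum-mono-≤ f≤c)

sum-nonNeg : {f : Vector ℚ n} → (∀ i → 0ℚ ≤ℚ f i) → 0ℚ ≤ℚ sum f
sum-nonNeg {n} {f} 0≤f = subst (_≤ℚ sum f) (sum-replicate-zero n) (sum-mono-≤ 0≤f)

term≤sum : {f : Vector ℚ n} → (∀ i → 0ℚ ≤ℚ f i) → ∀ i → f i ≤ℚ sum f
term≤sum {f = f} 0≤f zero =
  subst (_≤ℚ sum f) (ℚ.+-identityʳ (f zero)) (ℚ.+-monoʳ-≤ (f zero) (sum-nonNeg (0≤f ∘ suc)))
term≤sum {f = f} 0≤f (suc i) =
  subst (_≤ℚ sum f) (ℚ.+-identityˡ (f (suc i))) (ℚ.+-mono-≤ (0≤f zero) (term≤sum (0≤f ∘ suc) i))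

sum≡0⇒term≡0 : {f : Vector ℚ n} → (∀ i → 0ℚ ≤ℚ f i) → sum f ≡ 0ℚ → ∀ i → f i ≡ 0ℚ
sum≡0⇒term≡0 0≤f eq i = ℚ.≤-antisym (subst (_ ≤ℚ_) eq (term≤sum 0≤f i)) (0≤f i)

-- Unit vectors and fibre counts.

-- δ i is definitionally 𝐞 G i, which does not depend on the graph G.
δ : Fin n → Vector ℚ n
δ i k = if does (i Fin.≟ k) then 1ℚ else 0ℚ

δ-nonNeg : (i k : Fin n) → 0ℚ ≤ℚ δ i k
δ-nonNeg i k with i Fin.≟ k
... | yes _ = ℚ.nonNegative⁻¹ 1ℚ
... | no  _ = ℚ.≤-refl

δ-self : (i : Fin n) → δ i i ≡ 1ℚ
δ-self i with i Fin.≟ i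
... | yes _   = refl
... | no  i≢i = contradiction refl i≢i

-- Stated for an arbitrary diagonal entry `c` so as to serve both the unit vectors, with `c` equal
-- to 1, and the degree part of a Laplacian row.
diagonal-∙ : (c : ℚ) (i : Fin n) (f : Vector ℚ n) →
             (λ j → if does (i Fin.≟ j) then c else 0ℚ) ∙ f ≡ c * f i
diagonal-∙ {suc n} c zero f = begin
  c * f zero + (λ _ → 0ℚ) ∙ (f ∘ suc)   ≡⟨ cong (c * f zero +_) (∙-comm (λ _ → 0ℚ) (f ∘ suc)) ⟩
  c * f zero + (f ∘ suc) ∙ (λ _ → 0ℚ)   ≡⟨ cong (c * f zero +_) (∙-zeroʳ (f ∘ suc)) ⟩
  c * f zero + 0ℚ                       ≡⟨ ℚ.+-identityʳ _ ⟩
  c * f zero                            ∎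
diagonal-∙ {suc n} c (suc i) f = begin
  0ℚ * f zero + _       ≡⟨ cong₂ _+_ (ℚ.*-zeroˡ (f zero)) (diagonal-∙ c i (f ∘ suc)) ⟩
  0ℚ + c * f (suc i)    ≡⟨ ℚ.+-identityˡ _ ⟩
  c * f (suc i)         ∎

δ-∙ : (i : Fin n) (f : Vector ℚ n) → δ i ∙ f ≡ f i
δ-∙ i f = trans (diagonal-∙ 1ℚ i f) (ℚ.*-identityˡ (f i))

-- The value at `w` is the number of points that `p` sends to `w`, as a rational: the weight for
-- double counting along `p`.
fibres : (Fin k → Fin n) → Vector ℚ n
fibres {k} p w = ∑[ a < k ] δ (p a) w

fibres-nonNeg : (p : Fin k → Fin n) (w : Fin n) → 0ℚ ≤ℚ fibres p w
fibres-nonNeg p w = sum-nonNeg λ a → δ-nonNeg (p a) w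

fibres-image : (p : Fin k → Fin n) (a : Fin k) → 1ℚ ≤ℚ fibres p (p a)
fibres-image p a =
  subst (_≤ℚ fibres p (p a)) (δ-self (p a)) (term≤sum (λ a′ → δ-nonNeg (p a′) (p a)) a)

-- Change of variables along `p`: a sum over the target weighted by fibre sizes is a sum over the
-- source. It later turns sums over the flower into sums over a petal.
fibres-∙ : (p : Fin k → Fin n) (f : Vector ℚ n) → fibres p ∙ f ≡ ∑[ a < k ] f (p a)
fibres-∙ {k} {n} p f = begin
  ∑[ w < n ] ((∑[ a < k ] δ (p a) w) * f w)   ≡⟨ sum-cong-≗ (λ w → *-distribʳ-sum (f w) (λ a → δ (p a) w)) ⟩
  ∑[ w < n ] ∑[ a < k ] (δ (p a) w * f w)     ≡⟨ ∑-comm (λ w a → δ (p a) w * f w) ⟩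
  ∑[ a < k ] (δ (p a) ∙ f)                    ≡⟨ sum-cong-≗ (λ a → δ-∙ (p a) f) ⟩
  ∑[ a < k ] f (p a)                          ∎

-- Symmetric forms and the Dirichlet principle.

⊙-symmetric : {L : Matrix n n} → L ᵀ ≐ L → ∀ u i → (u ⊙ L) i ≡ (L ⊛ u) i
⊙-symmetric {L = L} L-sym u i = trans (∙-comm u ((L ᵀ) i)) (∙-cong {v = u} (L-sym i) (λ _ → refl))

⊛-selfAdjoint : {L : Matrix n n} → L ᵀ ≐ L → ∀ u v → u ∙ (L ⊛ v) ≡ v ∙ (L ⊛ u)
⊛-selfAdjoint {L = L} L-sym u v = begin
  u ∙ (L ⊛ v)    ≡⟨ ∙-assoc u L v ⟨
  (u ⊙ L) ∙ v    ≡⟨ ∙-cong {v = v} (⊙-symmetric L-sym u) (λ _ → refl) ⟩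
  (L ⊛ u) ∙ v    ≡⟨ ∙-comm (L ⊛ u) v ⟩
  v ∙ (L ⊛ u)    ∎

-- The difference of the two sides is the value of the form at p - f.
dirichlet : {L : Matrix n n} → L ᵀ ≐ L → (∀ v → 0ℚ ≤ℚ v ∙ (L ⊛ v)) →
            ∀ {b p} → L ⊛ p ≗ b → ∀ f → f ∙ b + f ∙ b ≤ℚ b ∙ p + f ∙ (L ⊛ f)
dirichlet {L = L} L-sym L-nonNeg {b} {p} Lp≗b f = 0≤q-p⇒p≤q (subst (0ℚ ≤ℚ_) w∙Lw≡ (L-nonNeg w))
  where
  w : Vector ℚ _
  w i = p i - f i
  Lw : ∀ i → (L ⊛ w) i ≡ b i - (L ⊛ f) i
  Lw i = trans (∙-distribˡ-- (L i) p f) (cong (_- (L ⊛ f) i) (Lp≗b i))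
  w∙b : w ∙ b ≡ b ∙ p - f ∙ b
  w∙b = begin
    w ∙ b            ≡⟨ ∙-comm w b ⟩
    b ∙ w            ≡⟨ ∙-distribˡ-- b p f ⟩
    b ∙ p - b ∙ f    ≡⟨ cong (λ t → b ∙ p - t) (∙-comm b f) ⟩
    b ∙ p - f ∙ b    ∎
  w∙Lf : w ∙ (L ⊛ f) ≡ f ∙ b - f ∙ (L ⊛ f)
  w∙Lf = begin
    w ∙ (L ⊛ f)                      ≡⟨ ⊛-selfAdjoint L-sym w f ⟩
    f ∙ (L ⊛ w)                      ≡⟨ ∙-cong {u = f} (λ _ → refl) Lw ⟩
    f ∙ (λ i → b i - (L ⊛ f) i)      ≡⟨ ∙-distribˡ-- f b (L ⊛ f) ⟩
    f ∙ b - f ∙ (L ⊛ f)              ∎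
  w∙Lw≡ : w ∙ (L ⊛ w) ≡ b ∙ p + f ∙ (L ⊛ f) - (f ∙ b + f ∙ b)
  w∙Lw≡ = begin
    w ∙ (L ⊛ w)                                      ≡⟨ ∙-cong {u = w} (λ _ → refl) Lw ⟩
    w ∙ (λ i → b i - (L ⊛ f) i)                      ≡⟨ ∙-distribˡ-- w b (L ⊛ f) ⟩
    w ∙ b - w ∙ (L ⊛ f)                              ≡⟨ cong₂ _-_ w∙b w∙Lf ⟩
    b ∙ p - f ∙ b - (f ∙ b - f ∙ (L ⊛ f))            ≡⟨ solve 3 (λ r s t → r :- s :- (s :- t) := r :+ t :- (s :+ s)) refl (b ∙ p) (f ∙ b) (f ∙ (L ⊛ f)) ⟩
    b ∙ p + f ∙ (L ⊛ f) - (f ∙ b + f ∙ b)            ∎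

-- The Laplacian form of a graph, its kernel, and resistance.

module _ {N : ℕ} (G : Graph N) where

  open Graph G

  private
    L : Matrix N N
    L = laplacian G

  adjacency-sym : ∀ i j → adjacency G i j ≡ adjacency G j i
  adjacency-sym i j with adj? i j | adj? j i
  ... | yes _  | yes _  = refl
  ... | yes ij | no ¬ji = contradiction (adj-sym ij) ¬ji
  ... | no ¬ij | yes ji = contradiction (adj-sym ji) ¬ij
  ... | no _   | no _   = refl

  adjacency-cases : ∀ i j → (Adj i j × adjacency G i j ≡ 1ℚ) ⊎ adjacency G i j ≡ 0ℚ
  adjacency-cases i j with adj? i j
  ... | yes ij = inj₁ (ij , refl)
  ... | no  _  = inj₂ refl

  adjacency-adj : ∀ {i j} → Adj i j → adjacency G i j ≡ 1ℚ
  adjacency-adj {i} {j} ij with adj? i j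
  ... | yes _  = refl
  ... | no ¬ij = contradiction ij ¬ij

  adjacency-nonNeg : ∀ i j → 0ℚ ≤ℚ adjacency G i j
  adjacency-nonNeg i j with adjacency-cases i j
  ... | inj₁ (_ , eq) = subst (0ℚ ≤ℚ_) (sym eq) (ℚ.nonNegative⁻¹ 1ℚ)
  ... | inj₂ eq       = ℚ.≤-reflexive (sym eq)

  laplacian-sym : L ᵀ ≐ L
  laplacian-sym i j = cong₂ _-_ diagonal-sym (adjacency-sym j i)
    where
    diagonal-sym : (if does (j Fin.≟ i) then degree G j else 0ℚ) ≡
                   (if does (i Fin.≟ j) then degree G i else 0ℚ)
    diagonal-sym with j Fin.≟ i | i Fin.≟ j
    ... | yes refl | yes _   = refl
    ... | yes refl | no  i≢i = contradiction refl i≢i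
    ... | no  i≢i  | yes refl = contradiction refl i≢i
    ... | no  _    | no  _   = refl

  -- The degree is the row sum of the adjacency matrix, so the diagonal contributes the adjacency
  -- row paired with the constant vector `f i`.
  laplacian-⊛ : ∀ f i → (L ⊛ f) i ≡ ∑[ j < N ] (adjacency G i j * (f i - f j))
  laplacian-⊛ f i = begin
    L i ∙ f                              ≡⟨ ∙-comm (L i) f ⟩
    f ∙ L i                              ≡⟨ ∙-distribˡ-- f D A ⟩
    f ∙ D - f ∙ A                        ≡⟨ cong₂ _-_ (∙-comm f D) (∙-comm f A) ⟩
    D ∙ f - A ∙ f                        ≡⟨ cong (_- A ∙ f) (diagonal-∙ (degree G i) i f) ⟩
    degree G i * f i - A ∙ f             ≡⟨ cong (_- A ∙ f) (*-distribʳ-sum (f i) A) ⟩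
    A ∙ (λ _ → f i) - A ∙ f              ≡⟨ ∙-distribˡ-- A (λ _ → f i) f ⟨
    A ∙ (λ j → f i - f j)                ∎
    where
    A D : Vector ℚ N
    A = adjacency G i
    D j = if does (i Fin.≟ j) then degree G i else 0ℚ

  -- Every edge is counted twice, once in each direction.
  energy : Vector ℚ N → ℚ
  energy f = ∑[ i < N ] ∑[ j < N ] (adjacency G i j * ((f i - f j) * (f i - f j)))

  -- Adding the double sum to its transpose completes the square edge by edge. Doubling the form
  -- avoids division by 2, in line with `energy` counting ordered pairs.
  laplacian-energy : ∀ f → f ∙ (L ⊛ f) + f ∙ (L ⊛ f) ≡ energy f
  laplacian-energy f = begin
    f ∙ (L ⊛ f) + f ∙ (L ⊛ f)
      ≡⟨ cong₂ _+_ expand (trans expand (∑-comm term)) ⟩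
    (∑[ i < N ] ∑[ j < N ] term i j) + (∑[ i < N ] ∑[ j < N ] term j i)
      ≡⟨ ∑-distrib-+ (λ i → ∑[ j < N ] term i j) (λ i → ∑[ j < N ] term j i) ⟨
    ∑[ i < N ] ((∑[ j < N ] term i j) + (∑[ j < N ] term j i))
      ≡⟨ sum-cong-≗ (λ i → ∑-distrib-+ (term i) (λ j → term j i)) ⟨
    ∑[ i < N ] ∑[ j < N ] (term i j + term j i)
      ≡⟨ sum-cong-≗ (λ i → sum-cong-≗ (collect i)) ⟩
    energy f
      ∎
    where
    term : Fin N → Fin N → ℚ
    term i j = f i * (adjacency G i j * (f i - f j))
    expand : f ∙ (L ⊛ f) ≡ ∑[ i < N ] ∑[ j < N ] term i j
    expand = sum-cong-≗ λ i → trans (cong (f i *_) (laplacian-⊛ f i))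
                                    (*-distribˡ-sum (f i) (λ j → adjacency G i j * (f i - f j)))
    collect : ∀ i j → term i j + term j i ≡ adjacency G i j * ((f i - f j) * (f i - f j))
    collect i j = begin
      term i j + f j * (adjacency G j i * (f j - f i))
        ≡⟨ cong (λ a → term i j + f j * (a * (f j - f i))) (adjacency-sym j i) ⟩
      term i j + f j * (adjacency G i j * (f j - f i))
        ≡⟨ solve 3 (λ a x y → x :* (a :* (x :- y)) :+ y :* (a :* (y :- x)) := a :* ((x :- y) :* (x :- y)))
             refl (adjacency G i j) (f i) (f j) ⟩
      adjacency G i j * ((f i - f j) * (f i - f j))
        ∎

  energy-term-nonNeg : ∀ (f : Vector ℚ N) i j → 0ℚ ≤ℚ adjacency G i j * ((f i - f j) * (f i - f j))
  energy-term-nonNeg f i j = *-nonNeg (adjacency-nonNeg i j) (x*x≥0 (f i - f j))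

  -- A vanishing sum of nonnegative terms has only zero terms, so `f` agrees across every edge and
  -- hence along every path.
  energy≡0⇒constant : Connected G → ∀ f → energy f ≡ 0ℚ → ∀ u v → f u ≡ f v
  energy≡0⇒constant conn f eq u v = along (conn u v)
    where
    edge : ∀ {i j} → Adj i j → f i ≡ f j
    edge {i} {j} ij = begin
      f i                ≡⟨ solve 2 (λ x y → x := x :- y :+ y) refl (f i) (f j) ⟩
      f i - f j + f j    ≡⟨ cong (_+ f j) (x*x≡0⇒x≡0 (f i - f j) square≡0) ⟩
      0ℚ + f j           ≡⟨ ℚ.+-identityˡ (f j) ⟩
      f j                ∎
      where
      square≡0 : (f i - f j) * (f i - f j) ≡ 0ℚ
      square≡0 = begin
        (f i - f j) * (f i - f j)                       ≡⟨ ℚ.*-identityˡ _ ⟨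
        1ℚ * ((f i - f j) * (f i - f j))                ≡⟨ cong (_* _) (adjacency-adj ij) ⟨
        adjacency G i j * ((f i - f j) * (f i - f j))   ≡⟨ sum≡0⇒term≡0 (energy-term-nonNeg f i)
                                                             (sum≡0⇒term≡0 (λ i → sum-nonNeg (energy-term-nonNeg f i)) eq i) j ⟩
        0ℚ                                              ∎
    along : ∀ {u v} → Star Adj u v → f u ≡ f v
    along ε        = refl
    along (uv ◅ p) = trans (edge uv) (along p)

  laplacian-nonNeg : ∀ f → 0ℚ ≤ℚ f ∙ (L ⊛ f)
  laplacian-nonNeg f with ℚ.≤-total 0ℚ (f ∙ (L ⊛ f))
  ... | inj₁ 0≤q = 0≤q
  -- Twice the form is an energy, hence nonnegative; when the form q is at most 0, this gives 0 ≤ q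
  -- + q ≤ q.
  ... | inj₂ q≤0 = ℚ.≤-trans
    (subst (0ℚ ≤ℚ_) (sym (laplacian-energy f)) (sum-nonNeg λ i → sum-nonNeg (energy-term-nonNeg f i)))
    (subst (f ∙ (L ⊛ f) + f ∙ (L ⊛ f) ≤ℚ_) (ℚ.+-identityʳ _) (ℚ.+-monoʳ-≤ (f ∙ (L ⊛ f)) q≤0))

  module _ (conn : Connected G) (u v : Fin N) where

    private
      b p : Vector ℚ N
      b k = δ u k - δ v k
      p = L † ⊛ b
      -- With `b` as the new column, Greville's vector `d` is `p` itself, so his `c` is the residual
      -- b - L p, and `cA≡0` states that it is orthogonal to the columns of L.
      module Residual = Greville L (L †) (†-isMoorePenrose L) b

    ∙-dipole : ∀ f → f ∙ b ≡ f u - f v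
    ∙-dipole f = begin
      f ∙ b                ≡⟨ ∙-distribˡ-- f (δ u) (δ v) ⟩
      f ∙ δ u - f ∙ δ v    ≡⟨ cong₂ _-_ (∙-comm f (δ u)) (∙-comm f (δ v)) ⟩
      δ u ∙ f - δ v ∙ f    ≡⟨ cong₂ _-_ (δ-∙ u f) (δ-∙ v f) ⟩
      f u - f v            ∎

    -- The residual c = b - L L† b lies in the kernel of L, so it is constant,
    -- hence orthogonal to b and to the range of L, hence to itself.
    laplacian-potential : L ⊛ p ≗ b
    laplacian-potential i = begin
      (L ⊛ p) i                  ≡⟨ solve 2 (λ x y → y := x :- (x :- y)) refl (b i) ((L ⊛ p) i) ⟩
      b i - c i                  ≡⟨ cong (λ t → b i - t) (∙-definite c c∙c≡0 i) ⟩
      b i - 0ℚ                   ≡⟨ solve 1 (λ x → x :- con 0ℚ := x) refl (b i) ⟩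
      b i                        ∎
      where
      c : Vector ℚ N
      c = Residual.c
      c⊥range : ∀ w → c ∙ (L ⊛ w) ≡ 0ℚ
      c⊥range w = begin
        c ∙ (L ⊛ w)        ≡⟨ ∙-assoc c L w ⟨
        (c ⊙ L) ∙ w        ≡⟨ ∙-cong {v = w} Residual.cA≡0 (λ _ → refl) ⟩
        (λ _ → 0ℚ) ∙ w     ≡⟨ ∙-comm (λ _ → 0ℚ) w ⟩
        w ∙ (λ _ → 0ℚ)     ≡⟨ ∙-zeroʳ w ⟩
        0ℚ                 ∎
      c-constant : ∀ i j → c i ≡ c j
      c-constant = energy≡0⇒constant conn c
        (trans (sym (laplacian-energy c)) (cong₂ _+_ (c⊥range c) (c⊥range c)))
      c∙c≡0 : c ∙ c ≡ 0ℚ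
      c∙c≡0 = begin
        c ∙ c                  ≡⟨ ∙-distribˡ-- c b (L ⊛ p) ⟩
        c ∙ b - c ∙ (L ⊛ p)    ≡⟨ cong₂ _-_ (∙-dipole c) (c⊥range p) ⟩
        c u - c v - 0ℚ         ≡⟨ cong (λ t → t - c v - 0ℚ) (c-constant u v) ⟩
        c v - c v - 0ℚ         ≡⟨ solve 1 (λ x → x :- x :- con 0ℚ := con 0ℚ) refl (c v) ⟩
        0ℚ                     ∎

    -- For the potential `p`, the term `b ∙ p` in the Dirichlet principle is by definition the
    -- resistance.
    resistance-lower : ∀ f → (f u - f v) + (f u - f v) ≤ℚ resistance G u v + f ∙ (L ⊛ f)
    resistance-lower f = subst (λ t → t + t ≤ℚ resistance G u v + f ∙ (L ⊛ f)) (∙-dipole f)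
      (dirichlet laplacian-sym laplacian-nonNeg laplacian-potential f)

-- The tent function and the cyclic order of the petals.

-- For i ≤ n this is the distance from 0 to i on a cycle of length n.
tent : ℕ → ℕ → ℕ
tent n i = i ⊓ (n ∸ i)

tent-suc-≤ : ∀ n i → tent n (suc i) ≤ suc (tent n i)
tent-suc-≤ n i = ℕ.⊓-mono-≤ (ℕ.≤-refl {suc i})
  (ℕ.≤-trans (ℕ.∸-monoʳ-≤ n (ℕ.n≤1+n i)) (ℕ.n≤1+n (n ∸ i)))

tent-≤-suc : ∀ n i → tent n i ≤ suc (tent n (suc i))
tent-≤-suc n i = ℕ.⊓-mono-≤ (ℕ.m≤n+m i 2)
  (subst (λ j → n ∸ i ≤ suc j) (ℕ.pred[m∸n]≡m∸[1+n] n i) (ℕ.m≤n+m∸n (n ∸ i) 1))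

tent-top : ∀ n → tent n n ≡ 0
tent-top n = trans (cong (n ⊓_) (ℕ.n∸n≡0 n)) (ℕ.⊓-zeroʳ n)

tent-half : ∀ n → tent n ⌊ n /2⌋ ≡ ⌊ n /2⌋
tent-half n = ℕ.m≤n⇒m⊓n≡m (ℕ.m+n≤o⇒m≤o∸n ⌊ n /2⌋
  (subst (⌊ n /2⌋ ℕ.+ ⌊ n /2⌋ ≤_) (ℕ.⌊n/2⌋+⌈n/2⌉≡n n) (ℕ.+-monoʳ-≤ ⌊ n /2⌋ (ℕ.⌊n/2⌋≤⌈n/2⌉ n))))

-- For odd n, twice the half falls short by 1, which a third half absorbs because it is at least 1.
-- The factor 3 matters only through being less than 4 in the final comparison.
n≤3⌊n/2⌋ : ∀ {n} → 2 ≤ n → n ≤ ⌊ n /2⌋ ℕ.+ (⌊ n /2⌋ ℕ.+ ⌊ n /2⌋)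
n≤3⌊n/2⌋ {n} 2≤n = subst (_≤ ⌊ n /2⌋ ℕ.+ (⌊ n /2⌋ ℕ.+ ⌊ n /2⌋)) (ℕ.⌊n/2⌋+⌈n/2⌉≡n n)
  (ℕ.+-monoʳ-≤ ⌊ n /2⌋ (ℕ.≤-trans (⌈n/2⌉≤1+⌊n/2⌋ n) (ℕ.+-monoˡ-≤ ⌊ n /2⌋ (ℕ.⌊n/2⌋-mono 2≤n))))
  where
  ⌈n/2⌉≤1+⌊n/2⌋ : ∀ n → ℕ.⌈ n /2⌉ ≤ suc ⌊ n /2⌋
  ⌈n/2⌉≤1+⌊n/2⌋ zero          = z≤n
  ⌈n/2⌉≤1+⌊n/2⌋ (suc zero)    = ℕ.≤-refl
  ⌈n/2⌉≤1+⌊n/2⌋ (suc (suc n)) = s≤s (⌈n/2⌉≤1+⌊n/2⌋ n)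

toℕ-next : .{{_ : NonZero n}} (i : Fin n) → toℕ (next i) ≡ suc (toℕ i) % n
toℕ-next {n} i = toℕ-fromℕ< (m%n<n (suc (toℕ i)) n)

next-inject₁ : (i : Fin n) → next (inject₁ i) ≡ suc i
next-inject₁ {n} i = toℕ-injective (begin
  toℕ (next (inject₁ i))             ≡⟨ toℕ-next (inject₁ i) ⟩
  suc (toℕ (inject₁ i)) % suc n      ≡⟨ cong (λ k → suc k % suc n) (toℕ-inject₁ i) ⟩
  suc (toℕ i) % suc n                ≡⟨ m<n⇒m%n≡m (s≤s (toℕ<n i)) ⟩
  suc (toℕ i)                        ∎)

-- Before the last index `next` is the ordinary successor, so one pass from 0 reaches every index.
next-induction : .{{_ : NonZero n}} (0<n : 0 ℕ.< n) (P : Fin n → Set) →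
                 P (fromℕ< 0<n) → (∀ i → P i → P (next i)) → ∀ i → P i
next-induction {suc n} _ P P₀ step =
  <-weakInduction P P₀ λ i Pi → subst P (next-inject₁ i) (step (inject₁ i) Pi)

-- The only delicate index is the last: there `next` returns to 0 while the successor is n, and the
-- tent vanishes at both.
tent-next : .{{_ : NonZero n}} (i : Fin n) → tent n (toℕ (next i)) ≡ tent n (suc (toℕ i))
tent-next {n} i with ℕ.m≤n⇒m<n∨m≡n (toℕ<n i)
... | inj₁ 1+i<n = cong (tent n) (trans (toℕ-next i) (m<n⇒m%n≡m 1+i<n))
... | inj₂ 1+i≡n = begin
  tent n (toℕ (next i))        ≡⟨ cong (tent n) (toℕ-next i) ⟩
  tent n (suc (toℕ i) % n)     ≡⟨ cong (λ k → tent n (k % n)) 1+i≡n ⟩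
  tent n (n % n)               ≡⟨ cong (tent n) (n%n≡0 n) ⟩
  0                            ≡⟨ tent-top n ⟨
  tent n n                     ≡⟨ cong (tent n) 1+i≡n ⟨
  tent n (suc (toℕ i))         ∎

-- Connectivity and energy of the flower.

module Flower {m : ℕ} (G : Graph (suc m)) {x y : Fin (suc m)} (x≢y : x ≢ y)
              (n : ℕ) (3≤n : 3 ≤ n) where

  private
    0<n : 0 ℕ.< n
    0<n = ℕ.≤-trans (s≤s z≤n) 3≤n

    instance
      n≢0 : NonZero n
      n≢0 = >-nonZero 0<n

    F : Graph (n ℕ.* m)
    F = flower G x≢y n 3≤n

    ρ : Fin n → Fin (suc m) → Fin (n ℕ.* m)
    ρ = π G x≢y n 3≤n

  -- Inside a petal, paths are copied from `G`. Crossing a petal from x to y ends at the x of the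
  -- next petal, so every copy of x is joined to that of petal 0; a general path runs through these.
  connected : Connected G → Connected F
  connected conn u v with π-surjective G x≢y n 3≤n u | π-surjective G x≢y n 3≤n v
  ... | i , a , refl | j , b , refl =
    petal i a x ◅◅ reverse (Graph.adj-sym F) (around i) ◅◅ around j ◅◅ petal j x b
    where
    petal : ∀ i a b → Star (FlowerAdj G x≢y n 3≤n) (ρ i a) (ρ i b)
    petal i a b = gmap (ρ i) (λ {a} {b} ab → i , a , b , ab , refl , refl) (conn a b)
    step : ∀ i → Star (FlowerAdj G x≢y n 3≤n) (ρ i x) (ρ (next i) x)
    step i = subst (Star _ (ρ i x)) (π-glue G x≢y n 3≤n i) (petal i x y)
    around : ∀ i → Star (FlowerAdj G x≢y n 3≤n) (ρ (fromℕ< 0<n) x) (ρ i x)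
    around = next-induction 0<n (λ i → Star _ (ρ (fromℕ< 0<n) x) (ρ i x)) ε (λ i p → p ◅◅ step i)

  energy-bounded : ∀ f {c} → (∀ i a b → (f (ρ i a) - f (ρ i b)) * (f (ρ i a) - f (ρ i b)) ≤ℚ c) →
                   energy F f ≤ℚ n · (suc m · (suc m · c))
  energy-bounded f {c} f≤c = ℚ.≤-trans
    (sum-mono-≤ λ u → sum-mono-≤ λ w → cover u w)
    (subst (_≤ℚ n · (suc m · (suc m · c))) (sym regroup)
      (sum-bounded λ i → sum-bounded λ a → sum-bounded λ b → f≤c i a b))
    where
    q : Fin (n ℕ.* m) → Fin (n ℕ.* m) → ℚ
    q u w = (f u - f w) * (f u - f w)
    -- The two weights multiply to the number of pairs of vertices of petal i lying over (u , w).
    petal : Fin (n ℕ.* m) → Fin (n ℕ.* m) → Fin n → ℚ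
    petal u w i = fibres (ρ i) u * (fibres (ρ i) w * q u w)
    row-nonNeg : ∀ u w i → 0ℚ ≤ℚ fibres (ρ i) w * q u w
    row-nonNeg u w i = *-nonNeg (fibres-nonNeg (ρ i) w) (x*x≥0 (f u - f w))
    petal-nonNeg : ∀ u w i → 0ℚ ≤ℚ petal u w i
    petal-nonNeg u w i = *-nonNeg (fibres-nonNeg (ρ i) u) (row-nonNeg u w i)
    -- An edge of the flower comes from a pair of vertices of some petal; all
    -- such pairs are counted, since only a bound linear in n is needed.
    cover : ∀ u w → adjacency F u w * q u w ≤ℚ ∑[ i < n ] petal u w i
    cover u w with adjacency-cases F u w
    ... | inj₂ eq = subst (_≤ℚ ∑[ i < n ] petal u w i) (sym (trans (cong (_* q u w) eq) (ℚ.*-zeroˡ (q u w))))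
                      (sum-nonNeg (petal-nonNeg u w))
    ... | inj₁ ((i , a , b , _ , refl , refl) , eq) =
      subst (_≤ℚ ∑[ i < n ] petal u w i) (sym (trans (cong (_* q u w) eq) (ℚ.*-identityˡ (q u w))))
        (ℚ.≤-trans (1≤p⇒q≤p*q (fibres-image (ρ i) b) (x*x≥0 (f u - f w)))
        (ℚ.≤-trans (1≤p⇒q≤p*q (fibres-image (ρ i) a) (row-nonNeg u w i))
        (term≤sum (petal-nonNeg u w) i)))
    -- Once the petal index is moved outermost, `fibres-∙` is applied to each endpoint in turn.
    regroup : ∑[ u < n ℕ.* m ] ∑[ w < n ℕ.* m ] ∑[ i < n ] petal u w i ≡
              ∑[ i < n ] ∑[ a < suc m ] ∑[ b < suc m ] q (ρ i a) (ρ i b)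
    regroup = begin
      ∑[ u < n ℕ.* m ] ∑[ w < n ℕ.* m ] ∑[ i < n ] petal u w i
        ≡⟨ sum-cong-≗ (λ u → ∑-comm (petal u)) ⟩
      ∑[ u < n ℕ.* m ] ∑[ i < n ] ∑[ w < n ℕ.* m ] petal u w i
        ≡⟨ ∑-comm (λ u i → ∑[ w < n ℕ.* m ] petal u w i) ⟩
      ∑[ i < n ] ∑[ u < n ℕ.* m ] ∑[ w < n ℕ.* m ] petal u w i
        ≡⟨ sum-cong-≗ (λ i → sum-cong-≗ λ u →
             trans (sym (*-distribˡ-sum (fibres (ρ i) u) (λ w → fibres (ρ i) w * q u w)))
                   (cong (fibres (ρ i) u *_) (fibres-∙ (ρ i) (q u)))) ⟩
      ∑[ i < n ] (fibres (ρ i) ∙ (λ u → ∑[ b < suc m ] q u (ρ i b)))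
        ≡⟨ sum-cong-≗ (λ i → fibres-∙ (ρ i) (λ u → ∑[ b < suc m ] q u (ρ i b))) ⟩
      ∑[ i < n ] ∑[ a < suc m ] ∑[ b < suc m ] q (ρ i a) (ρ i b)
        ∎

  -- The tent-shaped potential and the resulting resistance bound.

  module _ {t : ℚ} (0≤t : 0ℚ ≤ℚ t) where

    level : ℕ → ℚ
    level k = tent n k · t

    -- `remQuot` recovers the petal of the representative other than y. The y of petal i therefore
    -- takes the level of the next petal, as the gluing demands.
    potential : Vector ℚ (n ℕ.* m)
    potential w = level (toℕ (proj₁ (remQuot {n} m w)))

    potential-π : ∀ i v → (y ≢ v × potential (ρ i v) ≡ level (toℕ i)) ⊎
                          (y ≡ v × potential (ρ i v) ≡ level (suc (toℕ i)))
    potential-π i v with y Fin.≟ v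
    ... | yes y≡v = inj₂ (y≡v , trans (cong (λ r → level (toℕ (proj₁ r))) (remQuot-combine (next i) _))
                                      (cong (_· t) (tent-next i)))
    ... | no  y≢v = inj₁ (y≢v , cong (λ r → level (toℕ (proj₁ r))) (remQuot-combine i _))

    potential-x : ∀ i → potential (ρ i x) ≡ level (toℕ i)
    potential-x i with potential-π i x
    ... | inj₁ (_   , eq) = eq
    ... | inj₂ (y≡x , _)  = ⊥-elim (x≢y (sym y≡x))

    -- On a petal the potential takes only two values, which differ by at most t.
    potential-step : ∀ i a b → potential (ρ i a) ≤ℚ t + potential (ρ i b)
    potential-step i a b with potential-π i a | potential-π i b
    ... | inj₁ (_ , p) | inj₁ (_ , q) rewrite p | q = ·-monoˡ-≤ 0≤t (ℕ.n≤1+n (tent n (toℕ i)))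
    ... | inj₁ (_ , p) | inj₂ (_ , q) rewrite p | q = ·-monoˡ-≤ 0≤t (tent-≤-suc n (toℕ i))
    ... | inj₂ (_ , p) | inj₁ (_ , q) rewrite p | q = ·-monoˡ-≤ 0≤t (tent-suc-≤ n (toℕ i))
    ... | inj₂ (_ , p) | inj₂ (_ , q) rewrite p | q = ·-monoˡ-≤ 0≤t (ℕ.n≤1+n (tent n (suc (toℕ i))))

    potential-energy : energy F potential ≤ℚ n · (suc m · (suc m · (t * t)))
    potential-energy = energy-bounded potential {t * t} λ i a b →
      square-bounded {potential (ρ i a)} {potential (ρ i b)} {t} (potential-step i a b) (potential-step i b a)

  half<n : ⌊ n /2⌋ ℕ.< n
  half<n = subst (λ k → ⌊ k /2⌋ ℕ.< k) (ℕ.suc-pred n) (ℕ.⌊n/2⌋<n (ℕ.pred n))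

  -- Write H for the potential gap, R for the resistance and E for the form. The hypothesis on `t`
  -- bounds the energy of each petal by `t`, so 2E ≤ n t ≤ 3H. Doubling 2H ≤ R + E then gives 4H ≤
  -- 2R + 3H, that is H ≤ 2R.
  maxResistance-lower : Connected G → ∀ {t} → 0ℚ ≤ℚ t → suc m · (suc m · (t * t)) ≤ℚ t →
                        ⌊ n /2⌋ · t ≤ℚ maxResistance F + maxResistance F
  maxResistance-lower conn {t} 0≤t s²t²≤t = ℚ.≤-trans
    (0≤q-p⇒p≤q (subst (0ℚ ≤ℚ_)
      (solve 2 (λ R H → R :+ R :+ (H :+ (H :+ H)) :- ((H :+ H) :+ (H :+ H)) := R :+ R :- H) refl R H)
      (p≤q⇒0≤q-p bound)))
    (ℚ.+-mono-≤ R≤max R≤max)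
    where
    u v : Fin (n ℕ.* m)
    u = ρ (fromℕ< half<n) x
    v = ρ (fromℕ< 0<n) x
    f : Vector ℚ (n ℕ.* m)
    f = potential 0≤t
    R H E : ℚ
    R = resistance F u v
    H = ⌊ n /2⌋ · t
    E = f ∙ (laplacian F ⊛ f)
    R≤max : R ≤ℚ maxResistance F
    R≤max = resistance≤maxResistance F u v
    gap : f u - f v ≡ H
    gap = begin
      f u - f v                      ≡⟨ cong₂ _-_ (potential-x 0≤t (fromℕ< half<n)) (potential-x 0≤t (fromℕ< 0<n)) ⟩
      level 0≤t (toℕ (fromℕ< half<n)) - level 0≤t (toℕ (fromℕ< 0<n))
                                     ≡⟨ cong₂ (λ j k → level 0≤t j - level 0≤t k) (toℕ-fromℕ< half<n) (toℕ-fromℕ< 0<n) ⟩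
      -- The level of petal 0 reduces to 0 by computation.
      level 0≤t ⌊ n /2⌋ - 0ℚ         ≡⟨ cong (λ k → k · t - 0ℚ) (tent-half n) ⟩
      H - 0ℚ                         ≡⟨ solve 1 (λ h → h :- con 0ℚ := h) refl H ⟩
      H                              ∎
    lower : H + H ≤ℚ R + E
    lower = subst (λ d → d + d ≤ℚ R + E) gap (resistance-lower F (connected conn) u v f)
    E+E≤3H : E + E ≤ℚ H + (H + H)
    E+E≤3H = subst₂ _≤ℚ_ (sym (laplacian-energy F f)) n·t≡
      (ℚ.≤-trans (potential-energy 0≤t) (ℚ.≤-trans (·-monoʳ-≤ n s²t²≤t) (·-monoˡ-≤ 0≤t (n≤3⌊n/2⌋ (ℕ.<⇒≤ 3≤n)))))
      where
      n·t≡ : (⌊ n /2⌋ ℕ.+ (⌊ n /2⌋ ℕ.+ ⌊ n /2⌋)) · t ≡ H + (H + H)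
      n·t≡ = trans (×-homo-+ t ⌊ n /2⌋ _) (cong (H +_) (×-homo-+ t ⌊ n /2⌋ ⌊ n /2⌋))
    bound : (H + H) + (H + H) ≤ℚ R + R + (H + (H + H))
    bound = ℚ.≤-trans (ℚ.+-mono-≤ lower lower)
      (subst (_≤ℚ R + R + (H + (H + H))) (solve 2 (λ r e → r :+ r :+ (e :+ e) := r :+ e :+ (r :+ e)) refl R E)
        (ℚ.+-monoʳ-≤ (R + R) E+E≤3H))

-- Divergence of the maximal resistance: choice of slope and threshold.

corollary3p6 : ∀ {m : ℕ} (G : Graph (suc m)) → Connected G →
    ∀ {x y : Fin (suc m)} (x≢y : x ≢ y) →
    ∀ (M : ℚ) → ∃[ N ] (∀ (n : ℕ) (3≤n : 3 ≤ n) → N ≤ n →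
    M < maxResistance (flower G x≢y n 3≤n))
-- With slope t = 1/d, the inequality 2M d < K says 2M < K t. For n ≥ 2K the half of n is at least
-- K, so K t is at most twice the maximal resistance.
corollary3p6 {m} G conn x≢y M with archimedean ((M + M) * (suc m · (suc m · 1ℚ)))
... | K , 2Md<K = K ℕ.+ K , λ n 3≤n 2K≤n → halve (ℚ.<-≤-trans 2M<K·t
  (ℚ.≤-trans (·-monoˡ-≤ 0≤t (K≤half 2K≤n))
    (Flower.maxResistance-lower G x≢y n 3≤n conn 0≤t (ℚ.≤-reflexive s²t²≡t))))
  where
  d t : ℚ
  -- This is the square of the number of vertices of `G`, the number of ordered pairs counted per
  -- petal. Its inverse `t` satisfies d t² = t, the extreme case of the slope condition.
  d = suc m · (suc m · 1ℚ)
  instance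
    d-pos : Positive d
    d-pos = positive (·-pos m (·-pos m (ℚ.positive⁻¹ 1ℚ)))
    d≢0 : ℚ.NonZero d
    d≢0 = ℚ.pos⇒nonZero d
  t = 1/ d
  instance
    t-pos : Positive t
    t-pos = ℚ.1/pos⇒pos d
  0≤t : 0ℚ ≤ℚ t
  0≤t = ℚ.<⇒≤ (ℚ.positive⁻¹ t)
  s²t²≡t : suc m · (suc m · (t * t)) ≡ t
  s²t²≡t = begin
    suc m · (suc m · (t * t))             ≡⟨ cong (λ z → suc m · (suc m · z)) (ℚ.*-identityˡ (t * t)) ⟨
    suc m · (suc m · (1ℚ * (t * t)))      ≡⟨ cong (suc m ·_) (×-assoc-* (suc m) 1ℚ (t * t)) ⟨
    suc m · ((suc m · 1ℚ) * (t * t))      ≡⟨ ×-assoc-* (suc m) (suc m · 1ℚ) (t * t) ⟨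
    d * (t * t)                           ≡⟨ ℚ.*-assoc d t t ⟨
    d * t * t                             ≡⟨ cong (_* t) (ℚ.*-inverseʳ d) ⟩
    1ℚ * t                                ≡⟨ ℚ.*-identityˡ t ⟩
    t                                     ∎
  2M<K·t : M + M < K · t
  2M<K·t = subst₂ _<_
    (trans (ℚ.*-assoc (M + M) d t) (trans (cong ((M + M) *_) (ℚ.*-inverseʳ d)) (ℚ.*-identityʳ (M + M))))
    (trans (×-assoc-* K 1ℚ t) (cong (K ·_) (ℚ.*-identityˡ t)))
    (ℚ.*-monoˡ-<-pos t 2Md<K)
  K≤half : ∀ {n} → K ℕ.+ K ≤ n → K ≤ ⌊ n /2⌋
  K≤half {n} 2K≤n = subst (_≤ ⌊ n /2⌋) (sym (ℕ.n≡⌊n+n/2⌋ K)) (ℕ.⌊n/2⌋-mono 2K≤n)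
  halve : ∀ {p q} → p + p < q + q → p < q
  halve {p} {q} 2p<2q with p ℚ.<? q
  ... | yes p<q = p<q
  ... | no  p≮q = contradiction (ℚ.<-≤-trans 2p<2q (ℚ.+-mono-≤ (ℚ.≮⇒≥ p≮q) (ℚ.≮⇒≥ p≮q))) (ℚ.<-irrefl refl)
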